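{- For all integers $r\ge 8$ and $m\ge 2$, the group $G_{m,r}=C_m^{\,r-5}\oplus C_{2m}^{\,4}\oplus C_{6m}$ satisfies $$\mathsf N_1(G_{m,r})-(r+9)m\ge m-r+1.$$ In particular, whenever $m\ge r$, the formula $\mathsf N_1(G)=\sum_{i} n_i$ (where $n_1\mid\cdots\mid n_r$ are the invariant factors of $G$) fails for $G=G_{m,r}$. Moreover, for every fixed integer $r\ge 8$, the difference between $\mathsf N_1(G)$ and $\sum_i n_i=\mathsf d^*(G)+\mathsf r(G)$ is unbounded as $G$ ranges over finite abelian groups of rank $r$.
   Context: All groups are finite, abelian and written additively; $C_n$ denotes the cyclic group of order $n$. The rank $\mathsf r(G)$ is the minimum number of generators of $G$. If $G\cong C_{n_1}\oplus\cdots\oplus C_{n_s}$ with $1<n_1\mid\cdots\mid n_s$ (invariant factors), then $\mathsf r(G)=s$ and $\mathsf d^*(G)=\sum_{i=1}^s(n_i-1)$. A minimal zero-sum sequence is a nonempty sequence of elements of $G$ with sum $0$ having no proper nonempty subsequence with sum $0$. The first Narkiewicz constant $\mathsf N_1(G)$ is the maximum length $\ell$ of an indexed sequence $g_1,\dots,g_\ell$ of elements of $G\setminus\{0\}$ with $g_1+\cdots+g_\ell=0$ such that there is exactly one partition of the index set $\{1,\dots,\ell\}$ into nonempty blocks with the property that for every block $I$ the subsequence $(g_i)_{i\in I}$ is a minimal zero-sum sequence. (Equal group elements at different indices are distinguished.) -}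

module Defs where

open import Algebra.Bundles using (AbelianGroup)
import Algebra.Construct.DirectProduct as DirectProduct
import Algebra.Construct.Terminal as Terminal
open import Algebra.Definitions.RawMonoid using (sum)
open import Algebra.Morphism.Structures using (module GroupMorphisms)
open import Data.Bool.Base using (if_then_else_)
open import Data.Fin.Base using (Fin)
open import Data.Fin.Subset using (Subset; Nonempty; Empty; _∩_; _⊂_; ⋃; ⊤)
open import Data.Integer.Base using (ℤ; +_; _+_; -_; _-_; 0ℤ)
open import Data.Integer.Divisibility.Signed
  using (_∣_; divides; ∣m∣n⇒∣m+n; ∣m⇒∣-m)
import Data.Integer.Properties as ℤ
open import Data.Integer.Tactic.RingSolver using (solve-∀)
open import Data.List.Base using (List; []; _∷_; [_]; _++_; map; replicate)
open import Data.List.Relation.Binary.Permutation.Propositional using (_↭_)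
open import Data.List.Relation.Unary.All using (All)
open import Data.List.Relation.Unary.AllPairs using (AllPairs)
open import Data.List.Relation.Unary.Linked using (Linked)
open import Data.Nat.Base as ℕ using (ℕ)
import Data.Nat.Divisibility as ℕ
import Data.Nat.ListAction as ℕ
open import Data.Product.Base using (∃-syntax; _×_; _,_)
open import Data.Vec.Base using (lookup)
open import Data.Vec.Functional using (Vector)
open import Function.Bundles using (Inverse)
open import Level using (0ℓ)
open import Relation.Binary.PropositionalEquality
  using (_≡_; refl; subst; setoid)
open import Relation.Nullary.Negation using (¬_)

infix 4 _≡_mod_ _≅_

-- A record rather than a synonym, so that x and y can be inferred.
record _≡_mod_ (x y : ℤ) (n : ℕ) : Set where
  constructor by
  field difference : + n ∣ x - y

private
  ≡⇒mod : ∀ {n x y} → x ≡ y → x ≡ y mod n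
  ≡⇒mod {n} {x} refl = by (divides 0ℤ (ℤ.+-inverseʳ x))

  mod-sym : ∀ {n x y} → x ≡ y mod n → y ≡ x mod n
  mod-sym {n} {x} {y} (by p) = by (subst (+ n ∣_) (lemma x y) (∣m⇒∣-m p))
    where
    lemma : ∀ a b → - (a - b) ≡ b - a
    lemma = solve-∀

  mod-trans : ∀ {n x y z} → x ≡ y mod n → y ≡ z mod n → x ≡ z mod n
  mod-trans {n} {x} {y} {z} (by p) (by q) =
    by (subst (+ n ∣_) (lemma x y z) (∣m∣n⇒∣m+n p q))
    where
    lemma : ∀ a b c → (a - b) + (b - c) ≡ a - c
    lemma = solve-∀

  mod-+ : ∀ {n x y u v} → x ≡ y mod n → u ≡ v mod n → (x + u) ≡ (y + v) mod n
  mod-+ {n} {x} {y} {u} {v} (by p) (by q) =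
    by (subst (+ n ∣_) (lemma x y u v) (∣m∣n⇒∣m+n p q))
    where
    lemma : ∀ a b c d → (a - b) + (c - d) ≡ (a + c) - (b + d)
    lemma = solve-∀

  mod-neg : ∀ {n x y} → x ≡ y mod n → (- x) ≡ (- y) mod n
  mod-neg {n} {x} {y} (by p) = by (subst (+ n ∣_) (lemma x y) (∣m⇒∣-m p))
    where
    lemma : ∀ a b → - (a - b) ≡ (- a) - (- b)
    lemma = solve-∀

-- The cyclic group of order n as ℤ / nℤ; only n > 0 is ever used, since
-- C 0 is infinite cyclic.
C : ℕ → AbelianGroup 0ℓ 0ℓ
C n = record
  { Carrier = ℤ
  ; _≈_     = λ x y → x ≡ y mod n
  ; _∙_     = _+_
  ; ε       = 0ℤ
  ; _⁻¹     = -_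
  ; isAbelianGroup = record
    { isGroup = record
      { isMonoid = record
        { isSemigroup = record
          { isMagma = record
            { isEquivalence = record
              { refl = ≡⇒mod refl ; sym = mod-sym ; trans = mod-trans }
            ; ∙-cong = mod-+
            }
          ; assoc = λ x y z → ≡⇒mod (ℤ.+-assoc x y z)
          }
        ; identity = (λ x → ≡⇒mod (ℤ.+-identityˡ x))
                   , (λ x → ≡⇒mod (ℤ.+-identityʳ x))
        }
      ; inverse = (λ x → ≡⇒mod (ℤ.+-inverseˡ x))
                , (λ x → ≡⇒mod (ℤ.+-inverseʳ x))
      ; ⁻¹-cong = mod-neg
      }
    ; comm = λ x y → ≡⇒mod (ℤ.+-comm x y)
    }
  }

⨁C : List ℕ → AbelianGroup 0ℓ 0ℓ
⨁C []       = Terminal.abelianGroup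
⨁C (n ∷ ns) = DirectProduct.abelianGroup (C n) (⨁C ns)

Finite : AbelianGroup 0ℓ 0ℓ → Set
Finite G = ∃[ n ] Inverse (AbelianGroup.setoid G) (setoid (Fin n))

_≅_ : AbelianGroup 0ℓ 0ℓ → AbelianGroup 0ℓ 0ℓ → Set
G ≅ H = ∃[ f ] IsGroupIsomorphism f
  where
  open GroupMorphisms (AbelianGroup.rawGroup G) (AbelianGroup.rawGroup H)

record InvariantFactors (G : AbelianGroup 0ℓ 0ℓ) : Set where
  field
    factors  : List ℕ
    all>1    : All (1 ℕ.<_) factors
    chain    : Linked ℕ._∣_ factors
    iso      : G ≅ ⨁C factors

  Σn : ℕ
  Σn = ℕ.sum factors

  d* : ℕ
  d* = ℕ.sum (map (ℕ._∸ 1) factors)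

module _ (G : AbelianGroup 0ℓ 0ℓ) where
  open AbelianGroup G using (Carrier; _≈_; _∙_; ε; _⁻¹; rawMonoid)

  -- The subgroup generated by s 0, …, s (k - 1).
  data Span {k} (s : Vector Carrier k) : Carrier → Set where
    gen  : ∀ i → Span s (s i)
    zero : Span s ε
    add  : ∀ {x y} → Span s x → Span s y → Span s (x ∙ y)
    neg  : ∀ {x} → Span s x → Span s (x ⁻¹)
    resp : ∀ {x y} → x ≈ y → Span s x → Span s y

  GeneratedBy : ℕ → Set
  GeneratedBy k = ∃[ s ] (∀ x → Span {k} s x)

  HasRank : ℕ → Set
  HasRank r = GeneratedBy r × (∀ k → GeneratedBy k → r ℕ.≤ k)

  -- The sum of g i over all i in I.
  subsum : ∀ {ℓ} → Vector Carrier ℓ → Subset ℓ → Carrier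
  subsum g I = sum rawMonoid (λ i → if lookup I i then g i else ε)

  -- The subsequence of g indexed by I is a minimal zero-sum sequence; its
  -- subsequences are those indexed by the subsets of I.
  IsMinimalZeroSum : ∀ {ℓ} → Vector Carrier ℓ → Subset ℓ → Set
  IsMinimalZeroSum g I =
    Nonempty I × subsum g I ≈ ε ×
    (∀ J → J ⊂ I → Nonempty J → ¬ (subsum g J ≈ ε))

  -- A partition is listed by its blocks.  As these are nonempty and pairwise
  -- disjoint, hence distinct, two such lists are the same partition exactly
  -- when they are permutations of each other.
  IsPartition : ∀ {ℓ} → List (Subset ℓ) → Set
  IsPartition P =
    All Nonempty P × AllPairs (λ I J → Empty (I ∩ J)) P × ⋃ P ≡ ⊤

  IsFactorization : ∀ {ℓ} → Vector Carrier ℓ → List (Subset ℓ) → Set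
  IsFactorization g P = IsPartition P × All (IsMinimalZeroSum g) P

  HasUniqueFactorization : ∀ {ℓ} → Vector Carrier ℓ → Set
  HasUniqueFactorization g =
    ∃[ P ] IsFactorization g P × (∀ Q → IsFactorization g Q → Q ↭ P)

  N₁-Admissible : ℕ → Set
  N₁-Admissible ℓ = ∃[ g ] (∀ (i : Fin ℓ) → ¬ (g i ≈ ε))
    × sum rawMonoid g ≈ ε × HasUniqueFactorization g

  -- N₁(G) = N.
  IsN₁ : ℕ → Set
  IsN₁ N = N₁-Admissible N × (∀ ℓ → N₁-Admissible ℓ → ℓ ℕ.≤ N)

-- C_m^{r-5} ⊕ C_{2m}^4 ⊕ C_{6m}, for r ≥ 5.
Gₘᵣ : ℕ → ℕ → AbelianGroup 0ℓ 0ℓ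
Gₘᵣ m r =
  ⨁C (replicate (r ℕ.∸ 5) m ++ replicate 4 (2 ℕ.* m) ++ [ 6 ℕ.* m ])

{-# OPTIONS --safe #-}
module Submission where

-- A zero-sum sequence without zero terms factors uniquely exactly when any two of its minimal
-- zero-sum blocks are equal or disjoint.  Every zero-sum free sequence of length ℓ > 0 extends by
-- one term to a minimal zero-sum sequence, whence N₁(G) ≥ ℓ + 1; the maximum exists since
-- admissible lengths are decidable and bounded.
--
-- The group C₂⁴ ⊕ C₆ has a zero-sum free sequence of length 10 (one more than d*) with only eight
-- distinct elements.  Let a₁, …, a₈ be their multiplicities and Λ ⊂ ℤ⁸ their lattice of relations.
-- Since ℤ⁸ / m Λ is isomorphic to C_m³ ⊕ C_2m⁴ ⊕ C_6m, the images of the unit vectors with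
-- multiplicities m aᵢ + (m - 1) form a zero-sum free sequence of length 10 m + 8 (m - 1) there, and
-- each further summand C_m contributes m - 1 copies of a generator.
--
-- The invariant factors are controlled by counting: if bG is generated by k elements, then the
-- (k + 1)-st largest invariant factor divides b.

open import Defs
open import Algebra.Bundles using (AbelianGroup)
import Algebra.Definitions.RawMonoid as RawMonoid
open import Algebra.Definitions.RawMonoid using (sum)
import Algebra.Morphism.Construct.Composition as Composition
import Algebra.Morphism.Construct.Identity as Identity
open import Algebra.Morphism.Structures using (module GroupMorphisms)
import Algebra.Properties.CommutativeSemigroup as CommutativeSemigroupProperties
import Algebra.Properties.Group as GroupProperties
import Data.Bool.Properties as Bool
open import Data.Fin.Base as Fin using (Fin; zero; suc; toℕ)
import Data.Fin.Properties as Fin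
open import Data.Fin.Subset
  using (Subset; Nonempty; Empty; inside; outside; _∈_; _∉_; _⊆_; _⊂_; _∩_; _∪_; _─_; _-_; ∁; ⊤; ⊥; ⋃;
         ⁅_⁆)
open import Data.Fin.Subset.Induction using (⊂-wellFounded; Acc; acc)
open import Data.Fin.Subset.Properties
open import Data.Integer.Base as ℤ using (ℤ; +_; 0ℤ; 1ℤ)
import Data.Integer.DivMod as ℤ
import Data.Integer.Divisibility.Signed as ℤ
import Data.Integer.Properties as ℤ
open import Data.Integer.Tactic.RingSolver using (solve-∀)
open import Data.List.Base as List using (List; []; _∷_; _++_; replicate; map; length)
open import Data.List.Membership.Propositional using () renaming (_∈_ to _∈ₗ_)
open import Data.List.Membership.Propositional.Properties.WithK using (unique∧set⇒bag)
import Data.List.Properties as List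
open import Data.List.Relation.Binary.BagAndSetEquality using (∼bag⇒↭)
open import Data.List.Relation.Binary.Permutation.Propositional using (_↭_)
open import Data.List.Relation.Binary.Permutation.Propositional.Properties using (∈-resp-↭)
open import Data.List.Relation.Unary.All as All using (All; []; _∷_)
import Data.List.Relation.Unary.All.Properties as All
open import Data.List.Relation.Unary.AllPairs using (AllPairs; []; _∷_)
open import Data.List.Relation.Unary.Any using (here; there)
open import Data.List.Relation.Unary.Linked as Linked using (Linked; [-]; _∷_)
import Data.List.Relation.Unary.Linked.Properties as Linked
open import Data.List.Relation.Unary.Unique.Propositional using (Unique)
import Data.Nat.Base as ℕ
open import Data.Nat.Base using (ℕ; _+_; _*_; _≤_)
open import Data.Nat.Coprimality using (Coprime; coprime-divisor)
import Data.Nat.Divisibility as ℕ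
import Data.Nat.GCD as ℕ
import Data.Nat.ListAction as ℕ
import Data.Nat.Properties as ℕ
import Data.Nat.Tactic.RingSolver as ℕ
open import Data.Product.Base using (_×_; ∃-syntax; Σ-syntax; _,_; proj₁; proj₂)
open import Data.Sum.Base using (_⊎_; inj₁; inj₂; [_,_]′)
open import Data.Unit.Polymorphic.Base using (tt)
open import Data.Vec.Base using ([]; _∷_; here; there; tabulate)
open import Data.Vec.Functional as Vector using (Vector; head; tail)
import Data.Vec.Properties as Vec
open import Function.Base using (_∘_; id)
open import Function.Bundles using (Inverse; mk⇔)
open import Level using (0ℓ)
open import Relation.Binary.PropositionalEquality as ≡ using (_≡_; _≢_; cong; cong₂; subst)
open import Relation.Nullary.Decidable
  using (Dec; yes; no; ¬?; does; _×-dec_; _⊎-dec_; _→-dec_; decidable-stable; toWitness;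
         dec-true; dec-false; map′)
open import Relation.Nullary.Negation using (¬_; contradiction)
open import Relation.Unary using (Decidable)

private variable
  b k ℓ n L : ℕ
  p q       : Subset ℓ
  ns        : List ℕ
  G H       : AbelianGroup 0ℓ 0ℓ

-- Differences of subsets and disjoint blocks

p∪[q─p]≡q : p ⊆ q → p ∪ (q ─ p) ≡ q
p∪[q─p]≡q {p = p} {q} p⊆q = ⊆-antisym
  (λ x∈ → [ p⊆q , p─q⊆p q p ]′ (x∈p∪q⁻ p (q ─ p) x∈))
  λ {x} x∈q → x∈p∪q⁺ (⊎-of x x∈q)
  where
  ⊎-of : ∀ x → x ∈ q → x ∈ p ⊎ x ∈ q ─ p
  ⊎-of x x∈q with x ∈? p
  ... | yes x∈p = inj₁ x∈p
  ... | no  x∉p = inj₂ (x∈p∧x∉q⇒x∈p─q x∈q x∉p)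

x∈p─q⇒x∉q : ∀ {x} → x ∈ p ─ q → x ∉ q
x∈p─q⇒x∉q {p = inside  ∷ p} {inside ∷ q} (there x∈) (there x∈q) = x∈p─q⇒x∉q {p = p} x∈ x∈q
x∈p─q⇒x∉q {p = outside ∷ p} {inside ∷ q} (there x∈) (there x∈q) = x∈p─q⇒x∉q {p = p} x∈ x∈q
x∈p─q⇒x∉q {p = s ∷ p} {outside ∷ q} (there x∈) (there x∈q) = x∈p─q⇒x∉q {p = p} x∈ x∈q

⊆-⋃ : ∀ {P : List (Subset ℓ)} → p ∈ₗ P → p ⊆ ⋃ P
⊆-⋃ {P = I ∷ P} (here ≡.refl) x∈ = p⊆p∪q (⋃ P) x∈
⊆-⋃ {P = I ∷ P} (there p∈P) x∈ = q⊆p∪q I (⋃ P) (⊆-⋃ p∈P x∈)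

∈-⋃⁻ : ∀ {x} (P : List (Subset ℓ)) → x ∈ ⋃ P → ∃[ I ] I ∈ₗ P × x ∈ I
∈-⋃⁻ [] x∈ = contradiction x∈ ∉⊥
∈-⋃⁻ (I ∷ P) x∈ with x∈p∪q⁻ I (⋃ P) x∈
... | inj₁ x∈I = I , here ≡.refl , x∈I
... | inj₂ x∈P = let J , J∈P , x∈J = ∈-⋃⁻ P x∈P in J , there J∈P , x∈J

-- A repeated block would be disjoint from itself, hence empty.
disjoint⇒unique : ∀ {P : List (Subset ℓ)} → All Nonempty P →
  AllPairs (λ I J → Empty (I ∩ J)) P → Unique P
disjoint⇒unique [] [] = []
disjoint⇒unique ((x , x∈I) ∷ ne) (d ∷ ds) =
  All.map (λ { ∅ ≡.refl → ∅ (x , x∈p∩q⁺ (x∈I , x∈I)) }) d ∷ disjoint⇒unique ne ds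

∈-disjoint : ∀ {P : List (Subset ℓ)} → AllPairs (λ I J → Empty (I ∩ J)) P →
  p ∈ₗ P → q ∈ₗ P → p ≡ q ⊎ Empty (p ∩ q)
∈-disjoint (d ∷ ds) (here ≡.refl) (here ≡.refl) = inj₁ ≡.refl
∈-disjoint (d ∷ ds) (here ≡.refl) (there q∈) = inj₂ (All.lookup d q∈)
∈-disjoint {p = p} {q} (d ∷ ds) (there p∈) (here ≡.refl) =
  inj₂ (subst Empty (∩-comm q p) (All.lookup d p∈))
∈-disjoint (d ∷ ds) (there p∈) (there q∈) = ∈-disjoint ds p∈ q∈

-- Unique factorizations

module Sequences (G : AbelianGroup 0ℓ 0ℓ) where
  open AbelianGroup G
  open GroupProperties group
  open CommutativeSemigroupProperties commutativeSemigroup using (x∙yz≈y∙xz)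
  open import Relation.Binary.Reasoning.Setoid setoid

  subsum-⊥ : ∀ (g : Vector Carrier ℓ) → subsum G g ⊥ ≈ ε
  subsum-⊥ {ℕ.zero} g = refl
  subsum-⊥ {ℕ.suc ℓ} g = trans (identityˡ _) (subsum-⊥ (tail g))

  subsum-⊤ : ∀ (g : Vector Carrier ℓ) → subsum G g ⊤ ≈ sum rawMonoid g
  subsum-⊤ {ℕ.zero} g = refl
  subsum-⊤ {ℕ.suc ℓ} g = ∙-congˡ (subsum-⊤ (tail g))

  subsum-⁅⁆ : ∀ (g : Vector Carrier ℓ) i → subsum G g ⁅ i ⁆ ≈ g i
  subsum-⁅⁆ g zero = trans (∙-congˡ (subsum-⊥ (tail g))) (identityʳ (g zero))
  subsum-⁅⁆ g (suc i) = trans (identityˡ _) (subsum-⁅⁆ (tail g) i)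

  subsum-cong : ∀ {g h : Vector Carrier ℓ} → (∀ i → g i ≈ h i) →
    ∀ p → subsum G g p ≈ subsum G h p
  subsum-cong g≈h [] = refl
  subsum-cong g≈h (inside ∷ p) = ∙-cong (g≈h zero) (subsum-cong (g≈h ∘ suc) p)
  subsum-cong g≈h (outside ∷ p) = ∙-congˡ (subsum-cong (g≈h ∘ suc) p)

  subsum-─ : ∀ (g : Vector Carrier ℓ) p q → q ⊆ p →
    subsum G g p ≈ subsum G g q ∙ subsum G g (p ─ q)
  subsum-─ g [] [] q⊆p = sym (identityˡ ε)
  subsum-─ g (outside ∷ p) (inside ∷ q) q⊆p with () ← q⊆p here
  subsum-─ g (inside ∷ p) (inside ∷ q) q⊆p = begin
    g zero ∙ _ ≈⟨ ∙-congˡ (subsum-─ (tail g) p q (drop-∷-⊆ q⊆p)) ⟩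
    g zero ∙ (_ ∙ _) ≈⟨ assoc _ _ _ ⟨
    g zero ∙ _ ∙ _ ≈⟨ ∙-congˡ (identityˡ _) ⟨
    g zero ∙ _ ∙ (ε ∙ _) ∎
  subsum-─ g (s ∷ p) (outside ∷ q) q⊆p = begin
    _ ∙ _ ≈⟨ ∙-congˡ (subsum-─ (tail g) p q (drop-∷-⊆ q⊆p)) ⟩
    _ ∙ (_ ∙ _) ≈⟨ x∙yz≈y∙xz _ _ _ ⟩
    _ ∙ (_ ∙ _) ≈⟨ ∙-congʳ (identityˡ _) ⟨
    ε ∙ _ ∙ (_ ∙ _) ∎

  subsum-─≈ε : ∀ (g : Vector Carrier ℓ) {p q} → q ⊆ p →
    subsum G g q ≈ subsum G g p → subsum G g (p ─ q) ≈ ε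
  subsum-─≈ε g {p} {q} q⊆p eq = identityʳ-unique _ _ (sym (trans eq (subsum-─ g p q q⊆p)))

  -- A condition on pairs of subsets instead of lists of subsets. Over a finite group it can be
  -- decided by searching the finitely many pairs.
  Separated : Vector Carrier ℓ → Set
  Separated g = ∀ I J → IsMinimalZeroSum G g I → IsMinimalZeroSum G g J →
    I ≡ J ⊎ Empty (I ∩ J)

  -- Any element of a block of one factorization lies in some block of the other; the two blocks
  -- meet, so they coincide. Both lists thus have the same members, and being free of repetitions
  -- they are permutations of each other.
  separated⇒unique : ∀ {g : Vector Carrier ℓ} → Separated g →
    ∀ {P Q} → IsFactorization G g P → IsFactorization G g Q → Q ↭ P
  separated⇒unique sep {P} {Q} P-fac@((neP , disjP , _) , _) Q-fac@((neQ , disjQ , _) , _) =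
    ∼bag⇒↭ (unique∧set⇒bag (disjoint⇒unique neQ disjQ) (disjoint⇒unique neP disjP)
      (mk⇔ (block Q-fac P-fac) (block P-fac Q-fac)))
    where
    block : ∀ {P Q I} → IsFactorization G _ P → IsFactorization G _ Q → I ∈ₗ P → I ∈ₗ Q
    block {P} {Q} {I} ((ne , _) , mP) ((_ , _ , cover) , mQ) I∈P
      with x , x∈I ← All.lookup ne I∈P
      with J , J∈Q , x∈J ← ∈-⋃⁻ Q (subst (x ∈_) (≡.sym cover) ∈⊤)
      with sep I J (All.lookup mP I∈P) (All.lookup mQ J∈Q)
    ... | inj₁ ≡.refl = J∈Q
    ... | inj₂ ∅ = contradiction (x , x∈p∩q⁺ (x∈I , x∈J)) ∅

  ZeroSum : Vector Carrier ℓ → Subset ℓ → Set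
  ZeroSum g p = Nonempty p × subsum G g p ≈ ε

  module _ (_≈?_ : ∀ x y → Dec (x ≈ y)) where

    zeroSum? : ∀ (g : Vector Carrier ℓ) p → Dec (ZeroSum g p)
    zeroSum? g p = nonempty? p ×-dec (subsum G g p ≈? ε)

    -- Descent along `⊂`: as long as a proper zero-sum subset can be found it replaces `p`, and a
    -- failed search is exactly minimality.
    ∃minimal : ∀ (g : Vector Carrier ℓ) p → ZeroSum g p →
      ∃[ I ] I ⊆ p × IsMinimalZeroSum G g I
    ∃minimal g p zs = go p (⊂-wellFounded p) zs
      where
      go : ∀ p → Acc _⊂_ p → ZeroSum g p → ∃[ I ] I ⊆ p × IsMinimalZeroSum G g I
      go p (acc rs) (ne , s) with anySubset? (λ J → (J ⊂? p) ×-dec zeroSum? g J)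
      ... | yes (J , J⊂p , zs) = let I , I⊆J , m = go J (rs J⊂p) zs in
        I , ⊆-trans I⊆J (proj₁ J⊂p) , m
      ... | no none = p , id , ne , s , λ J J⊂p neJ sJ → none (J , J⊂p , neJ , sJ)

    -- Split off a minimal block `I`. The remainder `p ─ I` again has sum zero and is strictly
    -- smaller because `I` is nonempty.
    factorize : ∀ (g : Vector Carrier ℓ) p → subsum G g p ≈ ε →
      ∃[ P ] All Nonempty P × AllPairs (λ I J → Empty (I ∩ J)) P × ⋃ P ≡ p
        × All (IsMinimalZeroSum G g) P
    factorize g p s = go p (⊂-wellFounded p) s
      where
      go : ∀ p → Acc _⊂_ p → subsum G g p ≈ ε →
        ∃[ P ] All Nonempty P × AllPairs (λ I J → Empty (I ∩ J)) P × ⋃ P ≡ p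
          × All (IsMinimalZeroSum G g) P
      go p (acc rs) s with nonempty? p
      ... | no ∅ = [] , [] , [] , ≡.sym (Empty-unique ∅) , []
      ... | yes ne
        with I , I⊆p , m@((x , x∈I) , sI , _) ← ∃minimal g p (ne , s)
        with P , nes , ds , cover , ms ← go (p ─ I)
          (rs (p∩q≢∅⇒p─q⊂p p I (x , x∈p∩q⁺ (I⊆p x∈I , x∈I))))
          (subsum-─≈ε g I⊆p (trans sI (sym s)))
        = I ∷ P , proj₁ m ∷ nes , All.tabulate away ∷ ds
        , ≡.trans (cong (I ∪_) cover) (p∪[q─p]≡q I⊆p) , m ∷ ms
        where
        away : ∀ {J} → J ∈ₗ P → Empty (I ∩ J)
        away {J} J∈P (y , y∈) = let y∈I , y∈J = x∈p∩q⁻ I J y∈ in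
          x∈p─q⇒x∉q {p = p} (subst (y ∈_) cover (⊆-⋃ J∈P y∈J)) y∈I

    ∃factorization : ∀ {g : Vector Carrier ℓ} → sum rawMonoid g ≈ ε →
      ∃[ P ] IsFactorization G g P
    ∃factorization {g = g} s =
      let P , nes , ds , cover , ms = factorize g ⊤ (trans (subsum-⊤ g) s)
      in P , (nes , ds , cover) , ms

    separated⇒uniqueFactorization : ∀ {g : Vector Carrier ℓ} → sum rawMonoid g ≈ ε →
      Separated g → HasUniqueFactorization G g
    separated⇒uniqueFactorization s sep =
      let P , fac = ∃factorization s
      in P , fac , λ Q → separated⇒unique sep fac

    -- Every minimal zero-sum block can be completed to a factorization by factoring its complement.
    uniqueFactorization⇒separated : ∀ {g : Vector Carrier ℓ} → sum rawMonoid g ≈ ε →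
      HasUniqueFactorization G g → Separated g
    uniqueFactorization⇒separated {g = g} s (P , ((_ , disj , _) , _) , uniq) I J mI mJ =
      ∈-disjoint disj (block I mI) (block J mJ)
      where
      block : ∀ I → IsMinimalZeroSum G g I → I ∈ₗ P
      block I m@(ne , sI , _)
        with P′ , nes , ds , cover , ms ← factorize g (⊤ ─ I)
          (subsum-─≈ε g ⊆⊤ (trans sI (sym (trans (subsum-⊤ g) s))))
        = ∈-resp-↭ (uniq (I ∷ P′)
            ((ne ∷ nes , All.tabulate away ∷ ds
             , ≡.trans (cong (I ∪_) cover) (p∪[q─p]≡q ⊆⊤)) , m ∷ ms))
            (here ≡.refl)
        where
        away : ∀ {J} → J ∈ₗ P′ → Empty (I ∩ J)
        away {J} J∈P (y , y∈) = let y∈I , y∈J = x∈p∩q⁻ I J y∈ in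
          x∈p─q⇒x∉q {p = ⊤} (subst (y ∈_) cover (⊆-⋃ J∈P y∈J)) y∈I

-- Decidability and boundedness of admissible lengths

⟦_⟧ : ∀ {P : Fin ℓ → Set} → Decidable P → Subset ℓ
⟦ P? ⟧ = tabulate (does ∘ P?)

module _ {P : Fin ℓ → Set} (P? : Decidable P) where
  ∈⟦⟧⁺ : ∀ {i} → P i → i ∈ ⟦ P? ⟧
  ∈⟦⟧⁺ {i} Pi = Vec.lookup⇒[]= i _ (≡.trans (Vec.lookup∘tabulate _ i) (dec-true (P? i) Pi))

  ∈⟦⟧⁻ : ∀ {i} → i ∈ ⟦ P? ⟧ → P i
  ∈⟦⟧⁻ {i} i∈ = decidable-stable (P? i) λ ¬Pi → contradiction
    (≡.trans (≡.sym (Vec.[]=⇒lookup i∈)) (≡.trans (Vec.lookup∘tabulate _ i) (dec-false (P? i) ¬Pi)))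
    λ ()

IsLeast : Subset ℓ → Fin ℓ → Set
IsLeast p i = i ∈ p × (∀ j → j ∈ p → i Fin.≤ j)

isLeast? : ∀ (p : Subset ℓ) i → Dec (IsLeast p i)
isLeast? p i = (i ∈? p) ×-dec Fin.all? (λ j → (j ∈? p) →-dec (i Fin.≤? j))

∃least : Nonempty p → ∃[ i ] IsLeast p i
∃least {p = inside ∷ p} ne = zero , here , λ _ _ → ℕ.z≤n
∃least {p = outside ∷ p} (suc x , there x∈) =
  let i , i∈ , least = ∃least (x , x∈)
  in suc i , there i∈ , λ { (suc j) (there j∈) → ℕ.s≤s (least j j∈) }

-- Search downwards from the bound `b`; the known witness `a` stops the search at the latest.
∃max : ∀ {P : ℕ → Set} → Decidable P → ∀ a b → P a → (∀ k → P k → k ≤ b) →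
  ∃[ N ] P N × a ≤ N × (∀ k → P k → k ≤ N)
∃max P? a b Pa bound with P? b
∃max P? a b Pa bound | yes Pb = b , Pb , bound a Pa , bound
∃max P? a ℕ.zero Pa bound | no ¬Pb with ℕ.z≤n ← bound a Pa = contradiction Pa ¬Pb
∃max P? a (ℕ.suc b) Pa bound | no ¬Pb = ∃max P? a b Pa λ k Pk →
  ℕ.≤-pred (ℕ.≤∧≢⇒< (bound k Pk) λ { ≡.refl → ¬Pb Pk })

module FiniteGroup (G : AbelianGroup 0ℓ 0ℓ) (finite : Finite G) where
  open AbelianGroup G hiding (_-_)
  open Sequences G
  open Inverse (proj₂ finite)
  private order = proj₁ finite

  to-injective : ∀ {x y} → to x ≡ to y → x ≈ y
  to-injective {x} {y} eq =
    trans (sym (strictlyInverseʳ x)) (trans (from-cong eq) (strictlyInverseʳ y))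

  _≈?_ : ∀ x y → Dec (x ≈ y)
  x ≈? y = map′ to-injective to-cong (to x Fin.≟ to y)

  isMinimalZeroSum? : ∀ (g : Vector Carrier ℓ) p → Dec (IsMinimalZeroSum G g p)
  isMinimalZeroSum? g p = nonempty? p ×-dec (subsum G g p ≈? ε) ×-dec
    map′ (λ none J J⊂ ne s → none (J , J⊂ , ne , s)) (λ { m (J , J⊂ , ne , s) → m J J⊂ ne s })
      (¬? (anySubset? λ J → (J ⊂? p) ×-dec nonempty? J ×-dec (subsum G g J ≈? ε)))

  separated? : ∀ (g : Vector Carrier ℓ) → Dec (Separated g)
  separated? g = map′
    (λ none I J mI mJ → decidable-stable (eq-or-disjoint? I J)
      λ ¬eq → none (I , J , mI , mJ , ¬eq))
    (λ { sep (I , J , mI , mJ , ¬eq) → ¬eq (sep I J mI mJ) })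
    (¬? (anySubset? λ I → anySubset? λ J →
      isMinimalZeroSum? g I ×-dec isMinimalZeroSum? g J ×-dec ¬? (eq-or-disjoint? I J)))
    where
    eq-or-disjoint? : ∀ I J → Dec (I ≡ J ⊎ Empty (I ∩ J))
    eq-or-disjoint? I J = Vec.≡-dec Bool._≟_ I J ⊎-dec ¬? (nonempty? (I ∩ J))

  Admissible : Vector Carrier ℓ → Set
  Admissible g = (∀ i → ¬ (g i ≈ ε)) × sum rawMonoid g ≈ ε × Separated g

  admissible? : ∀ (g : Vector Carrier ℓ) → Dec (Admissible g)
  admissible? g = Fin.all? (λ i → ¬? (g i ≈? ε)) ×-dec (sum rawMonoid g ≈? ε) ×-dec separated? g

  isMinimalZeroSum-resp : ∀ {g h : Vector Carrier ℓ} → (∀ i → g i ≈ h i) →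
    ∀ {I} → IsMinimalZeroSum G g I → IsMinimalZeroSum G h I
  isMinimalZeroSum-resp g≈h {I} (ne , s , m) =
    ne , trans (sym (subsum-cong g≈h I)) s ,
    λ J J⊂ neJ sJ → m J J⊂ neJ (trans (subsum-cong g≈h J) sJ)

  -- Only finitely many sequences can be searched, namely those decoded from `Fin` codes. An
  -- arbitrary sequence agrees with its decoded form merely termwise and up to `≈`, so admissibility
  -- has to be transported.
  admissible-resp : ∀ {g h : Vector Carrier ℓ} → (∀ i → g i ≈ h i) → Admissible g → Admissible h
  admissible-resp {g = g} {h} g≈h (nz , s , sep) =
    (λ i hi≈ε → nz i (trans (g≈h i) hi≈ε)) ,
    (trans (sym (subsum-⊤ h)) (trans (sym (subsum-cong g≈h ⊤)) (trans (subsum-⊤ g) s))) ,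
    λ I J mI mJ → sep I J (back mI) (back mJ)
    where
    back : ∀ {I} → IsMinimalZeroSum G h I → IsMinimalZeroSum G g I
    back = isMinimalZeroSum-resp (λ i → sym (g≈h i))

  admissible⇒N₁ : ∀ {g : Vector Carrier ℓ} → Admissible g → N₁-Admissible G ℓ
  admissible⇒N₁ (nz , s , sep) = _ , nz , s , separated⇒uniqueFactorization _≈?_ s sep

  N₁⇒admissible : N₁-Admissible G ℓ → ∃[ g ] Admissible {ℓ} g
  N₁⇒admissible (g , nz , s , uniq) = g , nz , s , uniqueFactorization⇒separated _≈?_ s uniq

  N₁-admissible? : ∀ ℓ → Dec (N₁-Admissible G ℓ)
  N₁-admissible? ℓ = map′
    (λ (_ , adm) → admissible⇒N₁ adm)
    -- The search hits `g` at the code of its sequence of images under `to`.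
    (λ N₁ → let g , adm = N₁⇒admissible N₁ in Fin.funToFin (to ∘ g) , admissible-resp (λ i →
      sym (trans (from-cong (Fin.finToFun-funToFin (to ∘ g) i)) (strictlyInverseʳ (g i)))) adm)
    (Fin.any? λ k → admissible? (λ (i : Fin ℓ) → from (Fin.finToFun {order} k i)))

  -- The least elements of the minimal zero-sum blocks form a zero-sum free set whose complement
  -- is zero-sum free too, and by the pigeonhole principle for initial segments two such sets
  -- cannot cover order² indices.
  module _ {g : Vector Carrier ℓ} (nz : ∀ i → ¬ (g i ≈ ε)) (sep : Separated g) where

    IsRepresentative : Fin ℓ → Set
    IsRepresentative i = ∃[ I ] IsMinimalZeroSum G g I × IsLeast I i

    isRepresentative? : Decidable IsRepresentative
    isRepresentative? i = anySubset? λ I → isMinimalZeroSum? g I ×-dec isLeast? I i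

    reps : Subset ℓ
    reps = ⟦ isRepresentative? ⟧

    -- Such a set would contain a minimal block, whose least element is a representative.
    zeroSum⊈∁reps : ∀ p → p ⊆ ∁ reps → ¬ ZeroSum g p
    zeroSum⊈∁reps p p⊆ zs =
      let I , I⊆p , m = ∃minimal _≈?_ g p zs
          i , least = ∃least (proj₁ m)
      in x∈∁p⇒x∉p (p⊆ (I⊆p (proj₁ least))) (∈⟦⟧⁺ isRepresentative? (I , m , least))

    -- Take a minimal block `I` inside `reps` with least element `a`. If `I` is the singleton of
    -- `a`, then the term at `a` is zero. Otherwise another element `b` of `I` is the least element
    -- of some block `K`; as `K` meets `I`, separation gives `K ≡ I`, so `b` equals `a`.
    zeroSum⊈reps : ∀ p → p ⊆ reps → ¬ ZeroSum g p
    zeroSum⊈reps p p⊆ zs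
      with I , I⊆p , m@(ne , sI , _) ← ∃minimal _≈?_ g p zs
      with a , a∈I , a≤ ← ∃least ne
      with nonempty? (I - a)
    ... | no ∅ = nz a (begin
      g a ≈⟨ subsum-⁅⁆ g a ⟨
      subsum G g ⁅ a ⁆ ≈⟨ identityʳ _ ⟨
      subsum G g ⁅ a ⁆ ∙ ε ≈⟨ ∙-congˡ (subsum-⊥ g) ⟨
      subsum G g ⁅ a ⁆ ∙ subsum G g ⊥ ≡⟨ cong (λ q → _ ∙ subsum G g q) (Empty-unique ∅) ⟨
      subsum G g ⁅ a ⁆ ∙ subsum G g (I - a) ≈⟨ subsum-─ g I ⁅ a ⁆
        (λ x∈ → subst (_∈ I) (≡.sym (x∈⁅y⁆⇒x≡y a x∈)) a∈I) ⟨
      subsum G g I ≈⟨ sI ⟩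
      ε ∎)
      where open import Relation.Binary.Reasoning.Setoid setoid
    ... | yes (b , b∈)
      with K , mK , b∈K , b≤ ← ∈⟦⟧⁻ isRepresentative? (p⊆ (I⊆p (p─q⊆p I ⁅ a ⁆ b∈)))
      with sep I K m mK
    ... | inj₂ ∅ = ∅ (b , x∈p∩q⁺ (p─q⊆p I ⁅ a ⁆ b∈ , b∈K))
    ... | inj₁ ≡.refl = x∈p─q⇒x∉q {p = I} b∈
      (subst (_∈ ⁅ a ⁆) (Fin.≤-antisym (a≤ b b∈K) (b≤ a a∈I)) (x∈⁅x⁆ a))

    below : ℕ → Subset ℓ
    below k = ⟦ (λ i → toℕ i ℕ.<? k) ⟧

    ∩below-mono : ∀ p {j k} → j ≤ k → p ∩ below j ⊆ p ∩ below k
    ∩below-mono p {j} {k} j≤k x∈ = let x∈p , x∈j = x∈p∩q⁻ p (below j) x∈ in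
      x∈p∩q⁺ (x∈p , ∈⟦⟧⁺ (λ i → toℕ i ℕ.<? k) (ℕ.≤-trans (∈⟦⟧⁻ (λ i → toℕ i ℕ.<? j) x∈j) j≤k))

    partialSums : Fin (ℕ.suc ℓ) → Fin (order * order)
    partialSums k = Fin.combine (to (subsum G g (reps ∩ below (toℕ k))))
                                (to (subsum G g (∁ reps ∩ below (toℕ k))))

    -- There are ℓ + 1 initial segments and order² pairs of values. If the pairs at j < k agree, the
    -- parts of `reps` and of its complement lying between j and k both have sum zero. The index j
    -- belongs to one of them, which contradicts zero-sum freeness of that set.
    length<order² : ℓ ℕ.< order * order
    length<order² = ℕ.≮⇒≥ λ order²<ℓ+1 →
      let j , k , j<k , eq = Fin.pigeonhole order²<ℓ+1 partialSums
          eq₁ , eq₂ = Fin.combine-injective _ _ _ _ eq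
          -- The boundary `j` read as an index of the sequence: `j` is less than `k`, and `k` is at
          -- most ℓ.
          x = Fin.fromℕ< (ℕ.≤-trans j<k (ℕ.≤-pred (Fin.toℕ<n k)))
      in case j k j<k x (Fin.toℕ-fromℕ< _) (to-injective eq₁) (to-injective eq₂)
      where
      interval : ∀ p j k → toℕ j ℕ.< toℕ k → ∀ x → toℕ x ≡ toℕ j →
        subsum G g (p ∩ below (toℕ j)) ≈ subsum G g (p ∩ below (toℕ k)) →
        (∀ q → q ⊆ p → ¬ ZeroSum g q) → x ∉ p
      interval p j k j<k x x≡j eq free x∈p = free ((p ∩ below (toℕ k)) ─ (p ∩ below (toℕ j)))
        (λ y∈ → proj₁ (x∈p∩q⁻ p (below (toℕ k)) (p─q⊆p _ (p ∩ below (toℕ j)) y∈)))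
        ((x , x∈p∧x∉q⇒x∈p─q
           (x∈p∩q⁺ (x∈p , ∈⟦⟧⁺ (λ i → toℕ i ℕ.<? toℕ k) (subst (ℕ._< toℕ k) (≡.sym x≡j) j<k)))
           (λ x∈ → ℕ.<-irrefl x≡j (∈⟦⟧⁻ (λ i → toℕ i ℕ.<? toℕ j) (proj₂ (x∈p∩q⁻ p (below (toℕ j)) x∈))))) ,
         subsum-─≈ε g (∩below-mono p (ℕ.<⇒≤ j<k)) eq)

      case : ∀ (j k : Fin (ℕ.suc ℓ)) → toℕ j ℕ.< toℕ k → ∀ x → toℕ x ≡ toℕ j →
        subsum G g (reps ∩ below (toℕ j)) ≈ subsum G g (reps ∩ below (toℕ k)) →
        ¬ (subsum G g (∁ reps ∩ below (toℕ j)) ≈ subsum G g (∁ reps ∩ below (toℕ k)))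
      case j k j<k x x≡j eq₁ eq₂ = interval (∁ reps) j k j<k x x≡j eq₂ zeroSum⊈∁reps
        (x∉p⇒x∈∁p (interval reps j k j<k x x≡j eq₁ zeroSum⊈reps))

  ∃N₁ : ∀ ℓ → N₁-Admissible G ℓ → ∃[ N ] ℓ ≤ N × IsN₁ G N
  ∃N₁ ℓ adm =
    let N , admN , ℓ≤N , max = ∃max N₁-admissible? ℓ (order * order) adm bound in N , ℓ≤N , admN , max
    where
    bound : ∀ k → N₁-Admissible G k → k ≤ order * order
    bound k adm = let g , nz , s , sep = N₁⇒admissible adm in ℕ.<⇒≤ (length<order² nz sep)

-- Zero-sum free sequences

module ZeroSumFreeSequences (G : AbelianGroup 0ℓ 0ℓ) where
  open AbelianGroup G hiding (_-_)
  open GroupProperties group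
  open Sequences G
  open RawMonoid rawMonoid using () renaming (_×_ to _·_)

  ZeroSumFree : Vector Carrier ℓ → Set
  ZeroSumFree g = ∀ p → subsum G g p ≈ ε → Empty p

  module _ {g : Vector Carrier ℓ} (free : ZeroSumFree g) where
    complete : Vector Carrier (ℕ.suc ℓ)
    complete = (sum rawMonoid g ⁻¹) Vector.∷ g

    -- The argument in `Fin ℓ` encodes ℓ > 0: if the new term vanished, all of `g` would be a
    -- zero-sum set, and it must be seen to be nonempty.
    complete-nonzero : Fin ℓ → ∀ i → ¬ (complete i ≈ ε)
    complete-nonzero x zero s = free ⊤ (trans (subsum-⊤ g)
      (trans (sym (⁻¹-involutive _)) (trans (⁻¹-cong s) ε⁻¹≈ε))) (x , ∈⊤)
    complete-nonzero x (suc i) s = free ⁅ i ⁆ (trans (subsum-⁅⁆ g i) s) (i , x∈⁅x⁆ i)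

    -- A block without the new term would be a zero-sum subset of `g`. A block with it has the same
    -- sum over `g` as the full set, so the terms it omits sum to zero and there are none.
    minimalZeroSum⇒⊤ : ∀ p → IsMinimalZeroSum G complete p → p ≡ ⊤
    minimalZeroSum⇒⊤ (outside ∷ p) ((suc x , there x∈p) , s , _) =
      contradiction (x , x∈p) (free p (trans (sym (identityˡ _)) s))
    minimalZeroSum⇒⊤ (inside ∷ p) (_ , s , _) = cong (inside ∷_) (⊆-antisym ⊆⊤ λ {x} _ →
      decidable-stable (x ∈? p) λ x∉p →
        free (⊤ ─ p) (subsum-─≈ε g ⊆⊤ (trans p≈⊤ (sym (subsum-⊤ g)))) (x , x∈p∧x∉q⇒x∈p─q ∈⊤ x∉p))
      where
      p≈⊤ : subsum G g p ≈ sum rawMonoid g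
      p≈⊤ = trans (inverseʳ-unique _ _ s) (⁻¹-involutive _)

    zeroSumFree⇒N₁-admissible : Finite G → Fin ℓ → N₁-Admissible G (ℕ.suc ℓ)
    zeroSumFree⇒N₁-admissible finite x = FiniteGroup.admissible⇒N₁ G finite
      (complete-nonzero x , inverseˡ _ ,
       λ I J mI mJ → inj₁ (≡.trans (minimalZeroSum⇒⊤ I mI) (≡.sym (minimalZeroSum⇒⊤ J mJ))))

  -- Sequences given by terms with multiplicities

  repeat : ∀ b → Carrier → Vector Carrier ℓ → Vector Carrier (b + ℓ)
  repeat ℕ.zero x g = g
  repeat (ℕ.suc b) x g = x Vector.∷ repeat b x g

  -- Here `w` counts the chosen copies of `x` and `q` is the choice from `g`. The last component
  -- recovers emptiness of `p` from these data, since `p` itself is forgotten in favour of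
  -- multiplicities.
  subsum-repeat : ∀ b x (g : Vector Carrier ℓ) p →
    ∃[ w ] ∃[ q ] w ≤ b × subsum G (repeat b x g) p ≈ w · x ∙ subsum G g q
      × (w ≡ 0 → Empty q → Empty p)
  subsum-repeat ℕ.zero x g p = 0 , p , ℕ.z≤n , sym (identityˡ _) , λ _ ∅ → ∅
  subsum-repeat (ℕ.suc b) x g (inside ∷ p) =
    let w , q , w≤b , s , _ = subsum-repeat b x g p
    in ℕ.suc w , q , ℕ.s≤s w≤b , trans (∙-congˡ s) (sym (assoc _ _ _)) , λ ()
  subsum-repeat (ℕ.suc b) x g (outside ∷ p) =
    let w , q , w≤b , s , empty = subsum-repeat b x g p
    in w , q , ℕ.m≤n⇒m≤1+n w≤b , trans (identityˡ _) s ,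
       λ { w≡0 ∅ (suc i , there i∈p) → empty w≡0 ∅ (i , i∈p) }

  powers : ∀ (xs : List (ℕ × Carrier)) → Vector Carrier (ℕ.sum (map proj₁ xs))
  powers [] ()
  powers ((b , x) ∷ xs) = repeat b x (powers xs)

  -- `All` serves as a container of data: one admissible multiplicity per listed term.
  Multiplicities : List (ℕ × Carrier) → Set
  Multiplicities = All λ (b , _) → ∃[ w ] w ≤ b

  combination : ∀ {xs} → Multiplicities xs → Carrier
  combination [] = ε
  combination {(_ , x) ∷ _} ((w , _) ∷ ws) = w · x ∙ combination ws

  subsum-powers : ∀ xs p → ∃[ ws ] subsum G (powers xs) p ≈ combination {xs} ws
    × (All (_≡ 0) (All.reduce proj₁ ws) → Empty p)
  subsum-powers [] [] = [] , refl , λ { _ (() , _) }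
  subsum-powers ((b , x) ∷ xs) p =
    let w , q , w≤b , s , empty = subsum-repeat b x (powers xs) p
        ws , t , empty′ = subsum-powers xs q
    in (w , w≤b) ∷ ws , trans s (∙-congˡ t) , λ { (w≡0 ∷ ws≡0) → empty w≡0 (empty′ ws≡0) }

-- Multiples in direct sums and one more cyclic summand

scale : ∀ ns → ℕ → AbelianGroup.Carrier (⨁C ns) → AbelianGroup.Carrier (⨁C ns)
scale [] k _ = tt
scale (n ∷ ns) k (c , x) = + k ℤ.* c , scale ns k x

-- Elements are tuples of integer representatives, so iterated addition agrees with coordinatewise
-- multiplication even propositionally. The product form is what the ring solver can treat when `k`
-- is a variable.
·≡scale : ∀ ns k x → RawMonoid._×_ (AbelianGroup.rawMonoid (⨁C ns)) k x ≡ scale ns k x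
·≡scale [] k x = ≡.refl
·≡scale (n ∷ ns) ℕ.zero (c , x) = cong₂ _,_ (≡.sym (ℤ.*-zeroˡ c)) (·≡scale ns 0 x)
·≡scale (n ∷ ns) (ℕ.suc k) (c , x) = ≡.trans
  (cong (AbelianGroup._∙_ (⨁C (n ∷ ns)) (c , x)) (·≡scale (n ∷ ns) k (c , x)))
  (cong₂ _,_ (≡.sym (ℤ.suc-* (+ k) c)) (≡.trans
    (cong (AbelianGroup._∙_ (⨁C ns) x) (≡.sym (·≡scale ns k x))) (·≡scale ns (ℕ.suc k) x)))

module _ (ns : List ℕ) where
  open AbelianGroup (⨁C ns)
  open ZeroSumFreeSequences (⨁C ns)

  scaledSum : ∀ {xs} → Multiplicities xs → Carrier
  scaledSum [] = ε
  scaledSum {(_ , x) ∷ _} ((w , _) ∷ ws) = scale ns w x ∙ scaledSum ws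

  combination≡scaledSum : ∀ {xs} (ws : Multiplicities xs) → combination ws ≡ scaledSum ws
  combination≡scaledSum [] = ≡.refl
  combination≡scaledSum {(_ , x) ∷ _} ((w , _) ∷ ws) =
    cong₂ _∙_ (·≡scale ns w x) (combination≡scaledSum ws)

module _ (n : ℕ) .{{_ : ℕ.NonZero n}} (ns : List ℕ) where
  private
    module H = AbelianGroup (⨁C ns)
    module H′ = ZeroSumFreeSequences (⨁C ns)
    module G = AbelianGroup (⨁C (n ∷ ns))
  open ZeroSumFreeSequences (⨁C (n ∷ ns))

  embed : H.Carrier → G.Carrier
  embed x = 0ℤ , x

  proj₁-subsum-embed : ∀ (g : Vector H.Carrier ℓ) p → proj₁ (subsum (⨁C (n ∷ ns)) (embed ∘ g) p) ≡ 0ℤ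
  proj₁-subsum-embed g [] = ≡.refl
  proj₁-subsum-embed g (inside ∷ p) = cong (λ a → 0ℤ ℤ.+ a) (proj₁-subsum-embed (tail g) p)
  proj₁-subsum-embed g (outside ∷ p) = cong (λ a → 0ℤ ℤ.+ a) (proj₁-subsum-embed (tail g) p)

  proj₂-subsum-embed : ∀ (g : Vector H.Carrier ℓ) p →
    proj₂ (subsum (⨁C (n ∷ ns)) (embed ∘ g) p) ≡ subsum (⨁C ns) g p
  proj₂-subsum-embed g [] = ≡.refl
  proj₂-subsum-embed g (inside ∷ p) = cong (g zero H.∙_) (proj₂-subsum-embed (tail g) p)
  proj₂-subsum-embed g (outside ∷ p) = cong (H.ε H.∙_) (proj₂-subsum-embed (tail g) p)

  -- The first coordinate of a subsum is the number w of chosen generators. As w < n, it vanishes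
  -- modulo n only for w = 0, and then the other coordinates reduce to freeness of `g`.
  zeroSumFree-∷ : ∀ {g : Vector H.Carrier ℓ} → H′.ZeroSumFree g →
    ZeroSumFree (repeat (ℕ.pred n) (1ℤ , H.ε) (embed ∘ g))
  zeroSumFree-∷ {g = g} free p s
    with w , q , w≤ , s′ , empty ← subsum-repeat (ℕ.pred n) (1ℤ , H.ε) (embed ∘ g) p
    with coord , rest ← G.trans (G.sym s′) s
    rewrite ·≡scale (n ∷ ns) w (1ℤ , H.ε) | proj₁-subsum-embed g q | proj₂-subsum-embed g q
    with w
  ... | ℕ.zero = empty ≡.refl (free q (H.trans (H.sym (H.identityˡ _)) (H.trans
          (H.∙-congʳ (H.reflexive (·≡scale ns 0 H.ε))) rest)))
  ... | w@(ℕ.suc _) = contradiction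
          (ℤ.∣⇒∣ᵤ (subst (+ n ℤ.∣_) (simplify (+ w)) (_≡_mod_.difference coord)))
          (ℕ.>⇒∤ (ℕ.m≤pred[n]⇒suc[m]≤n w≤))
    where
    simplify : ∀ a → a ℤ.* 1ℤ ℤ.+ 0ℤ ℤ.- 0ℤ ≡ a
    simplify = solve-∀

-- By the conditions modulo 2, (u₁, …, u₇) is a codeword of the simplex code, hence of weight
-- s = 0 or s = 4, and u₈ + 2 s ≡ 0 modulo 6 with u₈ < 4 then forces u₈ = s = 0.
simplexRelation : ∀ {u₁} → u₁ ℕ.< 2 → ∀ {u₂} → u₂ ℕ.< 2 → ∀ {u₃} → u₃ ℕ.< 2 →
  ∀ {u₄} → u₄ ℕ.< 2 → 2 ℕ.∣ u₄ + (u₁ + (u₂ + u₃)) →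
  ∀ {u₅} → u₅ ℕ.< 2 → 2 ℕ.∣ u₅ + (u₁ + u₂) →
  ∀ {u₆} → u₆ ℕ.< 2 → 2 ℕ.∣ u₆ + (u₁ + u₃) →
  ∀ {u₇} → u₇ ℕ.< 2 → 2 ℕ.∣ u₇ + (u₂ + u₃) →
  ∀ {u₈} → u₈ ℕ.< 4 →
  let s = u₁ + (u₂ + (u₃ + (u₄ + (u₅ + (u₆ + u₇))))) in
  6 ℕ.∣ u₈ + (s + s) →
  All (_≡ 0) (u₁ ∷ u₂ ∷ u₃ ∷ u₄ ∷ u₅ ∷ u₆ ∷ u₇ ∷ u₈ ∷ [])
simplexRelation = toWitness {a? =
  all<2 λ u₁ → all<2 λ u₂ → all<2 λ u₃ →
  -- Testing each parity condition as soon as its variable is fixed leaves only the eight codewords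
  -- to be combined with `u₈`.
  all<2 λ u₄ → (2 ℕ.∣? u₄ + (u₁ + (u₂ + u₃))) →-dec
  (all<2 λ u₅ → (2 ℕ.∣? u₅ + (u₁ + u₂)) →-dec
  (all<2 λ u₆ → (2 ℕ.∣? u₆ + (u₁ + u₃)) →-dec
  (all<2 λ u₇ → (2 ℕ.∣? u₇ + (u₂ + u₃)) →-dec
  ℕ.allUpTo? (λ u₈ →
    let s = u₁ + (u₂ + (u₃ + (u₄ + (u₅ + (u₆ + u₇))))) in
    (6 ℕ.∣? u₈ + (s + s)) →-dec
      All.all? (ℕ._≟ 0) (u₁ ∷ u₂ ∷ u₃ ∷ u₄ ∷ u₅ ∷ u₆ ∷ u₇ ∷ u₈ ∷ [])) 4)))} _
  where
  all<2 : ∀ {P : ℕ → Set} → (∀ n → Dec (P n)) → Dec (∀ {n} → n ℕ.< 2 → P n)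
  all<2 P? = ℕ.allUpTo? P? 2

-- Zero-sum freeness for the multiples of the relation lattice

module _ (m : ℕ) .{{_ : ℕ.NonZero m}} where

  private
    leading : ∀ k w {t} → k * m ℕ.∣ w + t → m ℕ.∣ t → m ℕ.∣ w
    leading k w {t} r d = ℕ.∣m+n∣m⇒∣n (subst (m ℕ.∣_) (ℕ.+-comm w t) (ℕ.∣-trans (ℕ.n∣m*n k) r)) d

  -- Read modulo m, each relation from the fourth on shows that m divides its leading multiplicity.
  -- With every w equal to u m, the bounds 2m - 1 and 4m - 1, which are m a + (m - 1) for a = 1 and
  -- a = 3, become u < 2 and u < 4. Dividing the relations by m leaves those of `simplexRelation`.
  multiplicityRelation : ∀ {w₁ w₂ w₃ w₄ w₅ w₆ w₇ w₈} →
    let b = ℕ.pred (2 * m)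
        s = w₁ + (w₂ + (w₃ + (w₄ + (w₅ + (w₆ + w₇))))) in
    w₁ ≤ b → w₂ ≤ b → w₃ ≤ b → w₄ ≤ b → w₅ ≤ b → w₆ ≤ b → w₇ ≤ b →
    w₈ ≤ ℕ.pred (4 * m) →
    m ℕ.∣ w₁ → m ℕ.∣ w₂ → m ℕ.∣ w₃ →
    2 * m ℕ.∣ w₄ + (w₁ + (w₂ + w₃)) →
    2 * m ℕ.∣ w₅ + (w₁ + w₂) →
    2 * m ℕ.∣ w₆ + (w₁ + w₃) →
    2 * m ℕ.∣ w₇ + (w₂ + w₃) →
    6 * m ℕ.∣ w₈ + (s + s) →
    All (_≡ 0) (w₁ ∷ w₂ ∷ w₃ ∷ w₄ ∷ w₅ ∷ w₆ ∷ w₇ ∷ w₈ ∷ [])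
  multiplicityRelation {w₄ = w₄} {w₅} {w₆} {w₇} {w₈} b₁ b₂ b₃ b₄ b₅ b₆ b₇ b₈
    d₁@(ℕ.divides u₁ ≡.refl) d₂@(ℕ.divides u₂ ≡.refl) d₃@(ℕ.divides u₃ ≡.refl) r₄ r₅ r₆ r₇ r₈
    with d₄@(ℕ.divides u₄ ≡.refl) ← leading 2 w₄ r₄ (ℕ.∣m∣n⇒∣m+n d₁ (ℕ.∣m∣n⇒∣m+n d₂ d₃))
    with d₅@(ℕ.divides u₅ ≡.refl) ← leading 2 w₅ r₅ (ℕ.∣m∣n⇒∣m+n d₁ d₂)
    with d₆@(ℕ.divides u₆ ≡.refl) ← leading 2 w₆ r₆ (ℕ.∣m∣n⇒∣m+n d₁ d₃)
    with d₇@(ℕ.divides u₇ ≡.refl) ← leading 2 w₇ r₇ (ℕ.∣m∣n⇒∣m+n d₂ d₃)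
    with d ← ℕ.∣m∣n⇒∣m+n d₁ (ℕ.∣m∣n⇒∣m+n d₂ (ℕ.∣m∣n⇒∣m+n d₃
               (ℕ.∣m∣n⇒∣m+n d₄ (ℕ.∣m∣n⇒∣m+n d₅ (ℕ.∣m∣n⇒∣m+n d₆ d₇)))))
    with ℕ.divides u₈ ≡.refl ← leading 6 w₈ r₈ (ℕ.∣m∣n⇒∣m+n d d)
    = All.map⁺ (All.map (cong (_* m)) relation)
    where
    bound : ∀ k .{{_ : ℕ.NonZero k}} {u} → u * m ≤ ℕ.pred (k * m) → u ℕ.< k
    bound k {u} b = ℕ.*-cancelʳ-< m u k (ℕ.m≤pred[n]⇒suc[m]≤n {{ℕ.m*n≢0 k m}} b)

    reduce : ∀ k {a b} → a ≡ b * m → k * m ℕ.∣ a → k ℕ.∣ b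
    reduce k ≡.refl = ℕ.*-cancelʳ-∣ m

    factor₂ : ∀ m u a b → u * m + (a * m + b * m) ≡ (u + (a + b)) * m
    factor₂ = ℕ.solve-∀

    factor₃ : ∀ m u a b c → u * m + (a * m + (b * m + c * m))
      ≡ (u + (a + (b + c))) * m
    factor₃ = ℕ.solve-∀

    factor₇ : ∀ m a b c d e f g h →
      let s = a * m + (b * m + (c * m + (d * m +
                (e * m + (f * m + g * m)))))
          t = a + (b + (c + (d + (e + (f + g))))) in
      h * m + (s + s) ≡ (h + (t + t)) * m
    factor₇ = ℕ.solve-∀

    relation : All (_≡ 0) (u₁ ∷ u₂ ∷ u₃ ∷ u₄ ∷ u₅ ∷ u₆ ∷ u₇ ∷ u₈ ∷ [])
    relation = simplexRelation (bound 2 b₁) (bound 2 b₂) (bound 2 b₃)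
      (bound 2 b₄) (reduce 2 (factor₃ m u₄ u₁ u₂ u₃) r₄)
      (bound 2 b₅) (reduce 2 (factor₂ m u₅ u₁ u₂) r₅)
      (bound 2 b₆) (reduce 2 (factor₂ m u₆ u₁ u₃) r₆)
      (bound 2 b₇) (reduce 2 (factor₂ m u₇ u₂ u₃) r₇)
      (bound 4 b₈) (reduce 6 (factor₇ m u₁ u₂ u₃ u₄ u₅ u₆ u₇ u₈) r₈)

  factors₈ : List ℕ
  factors₈ = replicate 3 m ++ replicate 4 (2 * m) ++ List.[ 6 * m ]

  open ZeroSumFreeSequences (⨁C factors₈)

  -- The last five coordinates are the sequence over C₂⁴ ⊕ C₆.  The first three complete them to a
  -- unimodular matrix, so that m divides all multiplicities of a zero-sum subsequence.
  powers₈ : List (ℕ × AbelianGroup.Carrier (⨁C factors₈))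
  powers₈ =
    (ℕ.pred (2 * m) , + 1 , + 0 , + 0 , + 1 , + 1 , + 1 , + 0 , + 2 , tt) ∷
    (ℕ.pred (2 * m) , + 0 , + 1 , + 0 , + 1 , + 1 , + 0 , + 1 , + 2 , tt) ∷
    (ℕ.pred (2 * m) , + 0 , + 0 , + 1 , + 1 , + 0 , + 1 , + 1 , + 2 , tt) ∷
    (ℕ.pred (2 * m) , + 0 , + 0 , + 0 , + 1 , + 0 , + 0 , + 0 , + 2 , tt) ∷
    (ℕ.pred (2 * m) , + 0 , + 0 , + 0 , + 0 , + 1 , + 0 , + 0 , + 2 , tt) ∷
    (ℕ.pred (2 * m) , + 0 , + 0 , + 0 , + 0 , + 0 , + 1 , + 0 , + 2 , tt) ∷
    (ℕ.pred (2 * m) , + 0 , + 0 , + 0 , + 0 , + 0 , + 0 , + 1 , + 2 , tt) ∷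
    (ℕ.pred (4 * m) , + 0 , + 0 , + 0 , + 0 , + 0 , + 0 , + 0 , + 1 , tt) ∷ []

  scaledSum≈ε⇒0 : ∀ (ws : Multiplicities powers₈) →
    AbelianGroup._≈_ (⨁C factors₈) (scaledSum factors₈ ws) (AbelianGroup.ε (⨁C factors₈)) →
    All (_≡ 0) (All.reduce proj₁ ws)
  scaledSum≈ε⇒0
    ( (w₁ , b₁) ∷ (w₂ , b₂) ∷ (w₃ , b₃) ∷ (w₄ , b₄) ∷
      (w₅ , b₅) ∷ (w₆ , b₆) ∷ (w₇ , b₇) ∷ (w₈ , b₈) ∷ [])
    (q₁ , q₂ , q₃ , q₄ , q₅ , q₆ , q₇ , q₈ , _) =
    multiplicityRelation b₁ b₂ b₃ b₄ b₅ b₆ b₇ b₈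
      (at q₁ (instantiate coord1)) (at q₂ (instantiate coord2))
      (at q₃ (instantiate coord3)) (at q₄ (instantiate coord4))
      (at q₅ (instantiate coord5)) (at q₆ (instantiate coord6))
      (at q₇ (instantiate coord7)) (at q₈ (instantiate coord8))
    where
    -- The coordinate identities are proved for integer variables, where the ring solver applies,
    -- and specialised afterwards. Sums of casts then compute to casts of sums, as `at` expects.
    instantiate : ∀ {P : (a b c d e f g h : ℤ) → Set} → (∀ a b c d e f g h → P a b c d e f g h) →
      P (+ w₁) (+ w₂) (+ w₃) (+ w₄) (+ w₅) (+ w₆) (+ w₇) (+ w₈)
    instantiate p = p (+ w₁) (+ w₂) (+ w₃) (+ w₄) (+ w₅) (+ w₆) (+ w₇) (+ w₈)

    coord1 : ∀ a b c d e f g h → a ℤ.* + 1 ℤ.+ (b ℤ.* + 0 ℤ.+ (c ℤ.* + 0 ℤ.+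
      (d ℤ.* + 0 ℤ.+ (e ℤ.* + 0 ℤ.+ (f ℤ.* + 0 ℤ.+ (g ℤ.* + 0 ℤ.+ (h ℤ.* + 0 ℤ.+ 0ℤ))))))) ℤ.- 0ℤ
      ≡ a
    coord1 = solve-∀

    coord2 : ∀ a b c d e f g h → a ℤ.* + 0 ℤ.+ (b ℤ.* + 1 ℤ.+ (c ℤ.* + 0 ℤ.+
      (d ℤ.* + 0 ℤ.+ (e ℤ.* + 0 ℤ.+ (f ℤ.* + 0 ℤ.+ (g ℤ.* + 0 ℤ.+ (h ℤ.* + 0 ℤ.+ 0ℤ))))))) ℤ.- 0ℤ
      ≡ b
    coord2 = solve-∀

    coord3 : ∀ a b c d e f g h → a ℤ.* + 0 ℤ.+ (b ℤ.* + 0 ℤ.+ (c ℤ.* + 1 ℤ.+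
      (d ℤ.* + 0 ℤ.+ (e ℤ.* + 0 ℤ.+ (f ℤ.* + 0 ℤ.+ (g ℤ.* + 0 ℤ.+ (h ℤ.* + 0 ℤ.+ 0ℤ))))))) ℤ.- 0ℤ
      ≡ c
    coord3 = solve-∀

    coord4 : ∀ a b c d e f g h → a ℤ.* + 1 ℤ.+ (b ℤ.* + 1 ℤ.+ (c ℤ.* + 1 ℤ.+
      (d ℤ.* + 1 ℤ.+ (e ℤ.* + 0 ℤ.+ (f ℤ.* + 0 ℤ.+ (g ℤ.* + 0 ℤ.+ (h ℤ.* + 0 ℤ.+ 0ℤ))))))) ℤ.- 0ℤ
      ≡ d ℤ.+ (a ℤ.+ (b ℤ.+ c))
    coord4 = solve-∀

    coord5 : ∀ a b c d e f g h → a ℤ.* + 1 ℤ.+ (b ℤ.* + 1 ℤ.+ (c ℤ.* + 0 ℤ.+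
      (d ℤ.* + 0 ℤ.+ (e ℤ.* + 1 ℤ.+ (f ℤ.* + 0 ℤ.+ (g ℤ.* + 0 ℤ.+ (h ℤ.* + 0 ℤ.+ 0ℤ))))))) ℤ.- 0ℤ
      ≡ e ℤ.+ (a ℤ.+ b)
    coord5 = solve-∀

    coord6 : ∀ a b c d e f g h → a ℤ.* + 1 ℤ.+ (b ℤ.* + 0 ℤ.+ (c ℤ.* + 1 ℤ.+
      (d ℤ.* + 0 ℤ.+ (e ℤ.* + 0 ℤ.+ (f ℤ.* + 1 ℤ.+ (g ℤ.* + 0 ℤ.+ (h ℤ.* + 0 ℤ.+ 0ℤ))))))) ℤ.- 0ℤ
      ≡ f ℤ.+ (a ℤ.+ c)
    coord6 = solve-∀

    coord7 : ∀ a b c d e f g h → a ℤ.* + 0 ℤ.+ (b ℤ.* + 1 ℤ.+ (c ℤ.* + 1 ℤ.+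
      (d ℤ.* + 0 ℤ.+ (e ℤ.* + 0 ℤ.+ (f ℤ.* + 0 ℤ.+ (g ℤ.* + 1 ℤ.+ (h ℤ.* + 0 ℤ.+ 0ℤ))))))) ℤ.- 0ℤ
      ≡ g ℤ.+ (b ℤ.+ c)
    coord7 = solve-∀

    coord8 : ∀ a b c d e f g h → a ℤ.* + 2 ℤ.+ (b ℤ.* + 2 ℤ.+ (c ℤ.* + 2 ℤ.+
      (d ℤ.* + 2 ℤ.+ (e ℤ.* + 2 ℤ.+ (f ℤ.* + 2 ℤ.+ (g ℤ.* + 2 ℤ.+ (h ℤ.* + 1 ℤ.+ 0ℤ))))))) ℤ.- 0ℤ
      ≡ h ℤ.+ ((a ℤ.+ (b ℤ.+ (c ℤ.+ (d ℤ.+ (e ℤ.+ (f ℤ.+ g)))))) ℤ.+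
        (a ℤ.+ (b ℤ.+ (c ℤ.+ (d ℤ.+ (e ℤ.+ (f ℤ.+ g)))))))
    coord8 = solve-∀

    at : ∀ {n x k} → x ≡ 0ℤ mod n → x ℤ.- 0ℤ ≡ + k → n ℕ.∣ k
    at {n} (by d) eq = ℤ.∣⇒∣ᵤ (subst (+ n ℤ.∣_) eq d)

  powers₈-zeroSumFree : ZeroSumFree (powers powers₈)
  powers₈-zeroSumFree p s =
    let ws , s′ , empty = subsum-powers powers₈ p
    in empty (scaledSum≈ε⇒0 ws (G.trans (G.sym (G.reflexive (combination≡scaledSum factors₈ ws)))
         (G.trans (G.sym s′) s)))
    where module G = AbelianGroup (⨁C factors₈)

-- Congruences and direct sums of cyclic groups

module Mod n = AbelianGroup (C n)

mod-*ˡ : ∀ {n x y} c → x ≡ y mod n → (c ℤ.* x) ≡ (c ℤ.* y) mod n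
mod-*ˡ {n} {x} {y} c (by d) = by (subst (+ n ℤ.∣_) (distrib c x y) (ℤ.∣n⇒∣m*n c d))
  where
  distrib : ∀ c x y → c ℤ.* (x ℤ.- y) ≡ c ℤ.* x ℤ.- c ℤ.* y
  distrib = solve-∀

mod-*ʳ : ∀ {n x y} c → x ≡ y mod n → (x ℤ.* c) ≡ (y ℤ.* c) mod n
mod-*ʳ {n} {x} {y} c x≡y =
  ≡.subst₂ (λ a b → a ≡ b mod n) (ℤ.*-comm c x) (ℤ.*-comm c y) (mod-*ˡ c x≡y)

mod-∣ : ∀ {m n x y} → m ℕ.∣ n → x ≡ y mod n → x ≡ y mod m
mod-∣ m∣n (by d) = by (ℤ.∣-trans (ℤ.∣ᵤ⇒∣ m∣n) d)

mod-<⇒≡ : ∀ {n a b} → a ℕ.< n → b ℕ.< n → (+ a) ≡ (+ b) mod n → a ≡ b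
mod-<⇒≡ {n} {a} {b} a<n b<n (by d) = ℤ.+-injective (ℤ.i-j≡0⇒i≡j (+ a) (+ b) (ℤ.∣i∣≡0⇒i≡0 small))
  where
  ∣a-b∣<n : ℤ.∣ + a ℤ.- + b ∣ ℕ.< n
  ∣a-b∣<n = subst (ℕ._< n) (cong ℤ.∣_∣ (≡.sym (ℤ.m-n≡m⊖n a b)))
    (ℕ.≤-<-trans (ℤ.∣m⊝n∣≤m⊔n a b) (ℕ.⊔-pres-<m a<n b<n))

  small : ℤ.∣ + a ℤ.- + b ∣ ≡ 0
  small with ℤ.∣ + a ℤ.- + b ∣ | ∣a-b∣<n | ℤ.∣⇒∣ᵤ d
  ... | ℕ.zero | _ | _ = ≡.refl
  ... | ℕ.suc _ | lt | n∣ = contradiction n∣ (ℕ.>⇒∤ lt)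

module _ (n : ℕ) .{{_ : ℕ.NonZero n}} where

  residue : ℤ → Fin n
  residue x = Fin.fromℕ< (ℤ.n%ℕd<d x n)

  residue-≡ : ∀ x → (+ toℕ (residue x)) ≡ x mod n
  residue-≡ x = Mod.sym n (by (ℤ.divides (x ℤ./ℕ n) (≡.trans
    (cong₂ ℤ._-_ (ℤ.a≡a%ℕn+[a/ℕn]*n x n) (cong +_ (Fin.toℕ-fromℕ< (ℤ.n%ℕd<d x n))))
    (cancel (+ (x ℤ.%ℕ n)) _))))
    where
    cancel : ∀ a b → a ℤ.+ b ℤ.- a ≡ b
    cancel = solve-∀

  toℕ-mod-injective : ∀ {i j : Fin n} → (+ toℕ i) ≡ (+ toℕ j) mod n → i ≡ j
  toℕ-mod-injective i≡j = Fin.toℕ-injective (mod-<⇒≡ (Fin.toℕ<n _) (Fin.toℕ<n _) i≡j)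

  residue-cong : ∀ {x y} → x ≡ y mod n → residue x ≡ residue y
  residue-cong {x} {y} x≡y = toℕ-mod-injective
    (Mod.trans n (residue-≡ x) (Mod.trans n x≡y (Mod.sym n (residue-≡ y))))

⨁C-finite : ∀ {ns} → All ℕ.NonZero ns → Finite (⨁C ns)
⨁C-finite [] = 1 , record
  { to = λ _ → zero ; from = λ _ → tt ; to-cong = λ _ → ≡.refl ; from-cong = λ _ → tt
  ; inverse = (λ { {zero} _ → ≡.refl }) , λ _ → tt }
⨁C-finite {n ∷ ns} (n≢0 ∷ ns≢0) =
  n * proj₁ rest , record
  { to = to ; from = from
  ; to-cong = to-cong
  ; from-cong = λ { ≡.refl → Mod.refl n , H.refl }
  ; inverse = (λ {i} eq → ≡.trans (to-cong eq) (to∘from i))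
            , λ { {x} ≡.refl → from∘to x }
  }
  where
  instance _ = n≢0
  rest = ⨁C-finite ns≢0
  module H = AbelianGroup (⨁C ns)
  module G = AbelianGroup (⨁C (n ∷ ns))
  module I = Inverse (proj₂ rest)

  to : G.Carrier → Fin (n * proj₁ rest)
  to (x , y) = Fin.combine (residue n x) (I.to y)

  decode : Fin n × Fin (proj₁ rest) → G.Carrier
  decode (i , j) = + toℕ i , I.from j

  from : Fin (n * proj₁ rest) → G.Carrier
  from i = decode (Fin.remQuot {n} (proj₁ rest) i)

  to-cong : ∀ {x y} → x G.≈ y → to x ≡ to y
  to-cong (x≡ , y≈) = cong₂ Fin.combine (residue-cong n x≡) (I.to-cong y≈)

  to∘from : ∀ i → to (from i) ≡ i
  to∘from i = ≡.trans
    (cong₂ Fin.combine (toℕ-mod-injective n (residue-≡ n _)) (I.strictlyInverseˡ _))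
    (Fin.combine-remQuot {n} (proj₁ rest) i)

  from∘to : ∀ x → from (to x) G.≈ x
  from∘to (x , y) = subst (λ ij → decode ij G.≈ (x , y))
    (≡.sym (Fin.remQuot-combine (residue n x) (I.to y))) (residue-≡ n x , I.strictlyInverseʳ y)

-- Counting generators

dot : Vector ℤ k → Vector ℤ k → ℤ
dot {ℕ.zero} c v = 0ℤ
dot {ℕ.suc k} c v = head c ℤ.* head v ℤ.+ dot (tail c) (tail v)

dot-congˡ : ∀ {c d : Vector ℤ k} → (∀ j → c j ≡ d j mod n) → ∀ v → dot c v ≡ dot d v mod n
dot-congˡ {ℕ.zero} {n} c≡d v = Mod.refl n
dot-congˡ {ℕ.suc k} {n} c≡d v =
  Mod.∙-cong n (mod-*ʳ (head v) (c≡d zero)) (dot-congˡ (c≡d ∘ suc) (tail v))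

dot-0 : ∀ (v : Vector ℤ k) → dot (λ _ → 0ℤ) v ≡ 0ℤ
dot-0 {ℕ.zero} v = ≡.refl
dot-0 {ℕ.suc k} v = cong₂ ℤ._+_ (ℤ.*-zeroˡ (head v)) (dot-0 (tail v))

dot-+ : ∀ (c d v : Vector ℤ k) → dot (λ j → c j ℤ.+ d j) v ≡ dot c v ℤ.+ dot d v
dot-+ {ℕ.zero} c d v = ≡.refl
dot-+ {ℕ.suc k} c d v = ≡.trans (cong (λ x → (head c ℤ.+ head d) ℤ.* head v ℤ.+ x)
    (dot-+ (tail c) (tail d) (tail v)))
  (distrib (head c) (head d) (head v) (dot (tail c) (tail v)) (dot (tail d) (tail v)))
  where
  distrib : ∀ a b x y z → (a ℤ.+ b) ℤ.* x ℤ.+ (y ℤ.+ z) ≡ a ℤ.* x ℤ.+ y ℤ.+ (b ℤ.* x ℤ.+ z)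
  distrib = solve-∀

dot-neg : ∀ (c v : Vector ℤ k) → dot (λ j → ℤ.- c j) v ≡ ℤ.- dot c v
dot-neg {ℕ.zero} c v = ≡.refl
dot-neg {ℕ.suc k} c v = ≡.trans (cong (λ x → ℤ.- head c ℤ.* head v ℤ.+ x) (dot-neg (tail c) (tail v)))
  (distrib (head c) (head v) (dot (tail c) (tail v)))
  where
  distrib : ∀ a x y → ℤ.- a ℤ.* x ℤ.+ ℤ.- y ≡ ℤ.- (a ℤ.* x ℤ.+ y)
  distrib = solve-∀

unit : Fin k → Vector ℤ k
unit zero = 1ℤ Vector.∷ λ _ → 0ℤ
unit (suc i) = 0ℤ Vector.∷ unit i

dot-unit : ∀ i (v : Vector ℤ k) → dot (unit i) v ≡ v i
dot-unit zero v = ≡.trans (cong₂ ℤ._+_ (ℤ.*-identityˡ (head v)) (dot-0 (tail v))) (ℤ.+-identityʳ _)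
dot-unit (suc i) v = ≡.trans (cong₂ ℤ._+_ (ℤ.*-zeroˡ (head v)) (dot-unit i (tail v))) (ℤ.+-identityˡ _)

funToFin-cong : ∀ {m n} {f g : Fin m → Fin n} → (∀ i → f i ≡ g i) → Fin.funToFin f ≡ Fin.funToFin g
funToFin-cong {ℕ.zero} f≗g = ≡.refl
funToFin-cong {ℕ.suc m} f≗g = cong₂ Fin.combine (f≗g zero) (funToFin-cong (f≗g ∘ suc))

-- The coefficients matter only modulo n, so they reach at most n^k residue vectors, while there are
-- n^L of them.
few-generators : ∀ {n L k} → 1 ℕ.< n → k ℕ.< L → ∀ (v : Fin L → Vector ℤ k) →
  ¬ (∀ (z : Vector ℤ L) → ∃[ c ] ∀ i → z i ≡ dot c (v i) mod n)
few-generators {n} {L} {k} 1<n k<L v spans =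
  let a , b , a<b , eq = Fin.pigeonhole (ℕ.^-monoʳ-< n 1<n k<L) (Fin.funToFin ∘ residues)
  in Fin.<⇒≢ a<b (collision a b eq)
  where
  instance _ = ℕ.>-nonZero (ℕ.<⇒≤ 1<n)

  point : Fin (n ℕ.^ L) → Vector ℤ L
  point a i = + toℕ (Fin.finToFun a i)

  coefficients : Fin (n ℕ.^ L) → Vector ℤ k
  coefficients a = proj₁ (spans (point a))

  residues : Fin (n ℕ.^ L) → Fin k → Fin n
  residues a j = residue n (coefficients a j)

  collision : ∀ a b → Fin.funToFin (residues a) ≡ Fin.funToFin (residues b) → a ≡ b
  collision a b eq = ≡.trans (≡.sym (Fin.funToFin-finToFin {L} {n} a))
    (≡.trans (funToFin-cong same) (Fin.funToFin-finToFin {L} {n} b))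
    where
    open Mod n using (trans; sym)

    coefficients≡ : ∀ j → coefficients a j ≡ coefficients b j mod n
    coefficients≡ j = trans (sym (residue-≡ n _)) (trans (subst (λ r → (+ toℕ (residues a j)) ≡ (+ toℕ r) mod n)
      (≡.trans (≡.sym (Fin.finToFun-funToFin (residues a) j))
        (≡.trans (cong (λ e → Fin.finToFun e j) eq) (Fin.finToFun-funToFin (residues b) j)))
      (Mod.refl n)) (residue-≡ n _))

    same : ∀ i → Fin.finToFun {n} {L} a i ≡ Fin.finToFun {n} {L} b i
    same i = toℕ-mod-injective n (trans (proj₂ (spans (point a)) i)
      (trans (dot-congˡ coefficients≡ (v i)) (sym (proj₂ (spans (point b)) i))))

-- Put n = p g and b = q g with g the greatest common divisor. As p and q are coprime, b cancels
-- from the congruences and leaves them modulo p, which `few-generators` excludes for p > 1. So p =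
-- 1, and n = g divides b.
few-multiples : ∀ {n L k b} .{{_ : ℕ.NonZero n}} → k ℕ.< L → ∀ (v : Fin L → Vector ℤ k) →
  (∀ (z : Vector ℤ L) → ∃[ c ] ∀ i → (+ b ℤ.* z i) ≡ (+ b ℤ.* dot c (v i)) mod n) → n ℕ.∣ b
few-multiples {n} {L} {k} {b} k<L v spans = case (ℕ.gcd[m,n]∣m n b) (ℕ.gcd[m,n]∣n n b)
  where
  g = ℕ.gcd n b
  instance
    g≢0 : ℕ.NonZero g
    g≢0 = ℕ.≢-nonZero (ℕ.gcd[m,n]≢0 n b (inj₁ (ℕ.≢-nonZero⁻¹ n)))

  case : g ℕ.∣ n → g ℕ.∣ b → n ℕ.∣ b
  case (ℕ.divides p n≡pg) (ℕ.divides q b≡qg) with 1 ℕ.<? p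
  ... | no p≯1 = subst (ℕ._∣ b) (≡.sym (≡.trans n≡pg (cong (_* g) p≡1)))
                  (subst (ℕ._∣ b) (≡.sym (ℕ.*-identityˡ g)) (ℕ.gcd[m,n]∣n n b))
    where
    p≡1 : p ≡ 1
    p≡1 = ℕ.≤-antisym (ℕ.≮⇒≥ p≯1) (ℕ.n≢0⇒n>0 λ { ≡.refl → ℕ.≢-nonZero⁻¹ n n≡pg })
  ... | yes 1<p = contradiction (λ z → let c , eq = spans z in c , λ i → reduce (eq i))
                    (few-generators 1<p k<L v)
    where
    coprime : Coprime p q
    coprime {d} (d∣p , d∣q) = ℕ.∣1⇒≡1 (ℕ.*-cancelʳ-∣ g (subst (d * g ℕ.∣_) (≡.sym (ℕ.*-identityˡ g))
      (ℕ.gcd-greatest (subst (d * g ℕ.∣_) (≡.sym n≡pg) (ℕ.*-monoˡ-∣ g d∣p))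
                      (subst (d * g ℕ.∣_) (≡.sym b≡qg) (ℕ.*-monoˡ-∣ g d∣q)))))

    reduce : ∀ {x y} → (+ b ℤ.* x) ≡ (+ b ℤ.* y) mod n → x ≡ y mod p
    reduce {x} {y} (by d) = by (ℤ.∣ᵤ⇒∣ (coprime-divisor coprime (ℕ.*-cancelʳ-∣ g
      (≡.subst₂ ℕ._∣_ n≡pg (≡.trans (cong ℤ.∣_∣ (distrib (+ b) x y)) (≡.trans (ℤ.abs-* (+ b) (x ℤ.- y))
          (≡.trans (cong (_* _) b≡qg) (swap q g _))))
        (ℤ.∣⇒∣ᵤ d)))))
      where
      distrib : ∀ b x y → b ℤ.* x ℤ.- b ℤ.* y ≡ b ℤ.* (x ℤ.- y)
      distrib = solve-∀
      swap : ∀ q g t → q * g * t ≡ q * t * g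
      swap q g t = ≡.trans (ℕ.*-assoc q g t) (≡.trans (cong (q ℕ.*_) (ℕ.*-comm g t)) (≡.sym (ℕ.*-assoc q t g)))

-- A record rather than a synonym, so that G and H can be inferred.
record IsHom (G H : AbelianGroup 0ℓ 0ℓ)
             (f : AbelianGroup.Carrier G → AbelianGroup.Carrier H) : Set where
  constructor isHom
  open AbelianGroup
  field isGroupHomomorphism : GroupMorphisms.IsGroupHomomorphism (rawGroup G) (rawGroup H) f
  open GroupMorphisms.IsGroupHomomorphism isGroupHomomorphism public

module _ {G H : AbelianGroup 0ℓ 0ℓ} where
  private
    module G = AbelianGroup G
    module H = AbelianGroup H

  mkHom : ∀ f → (∀ {x y} → x G.≈ y → f x H.≈ f y) → (∀ x y → f (x G.∙ y) H.≈ f x H.∙ f y) →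
    f G.ε H.≈ H.ε → (∀ x → f (x G.⁻¹) H.≈ f x H.⁻¹) → IsHom G H f
  mkHom f cong-f ∙-homo ε-homo ⁻¹-homo = isHom record
    { isMonoidHomomorphism = record
      { isMagmaHomomorphism = record
        { isRelHomomorphism = record { cong = cong-f }
        ; homo = ∙-homo
        }
      ; ε-homo = ε-homo
      }
    ; ⁻¹-homo = ⁻¹-homo
    }

  ∘-hom : ∀ {K f g} → IsHom H K g → IsHom G H f → IsHom G K (g ∘ f)
  ∘-hom {K} (isHom g) (isHom f) = isHom (Composition.isGroupHomomorphism (AbelianGroup.trans K) f g)

  span-map : ∀ {f} → IsHom G H f → ∀ {s : Vector G.Carrier k} {t : Vector H.Carrier n} →
    (∀ i → Span H t (f (s i))) → ∀ {x} → Span G s x → Span H t (f x)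
  span-map hom gens (gen i) = gens i
  span-map hom gens zero = resp (H.sym ε-homo) zero
    where open IsHom hom
  span-map hom gens (add p q) = resp (H.sym (homo _ _)) (add (span-map hom gens p) (span-map hom gens q))
    where open IsHom hom
  span-map hom gens (neg p) = resp (H.sym (⁻¹-homo _)) (neg (span-map hom gens p))
    where open IsHom hom
  span-map hom gens (resp x≈y p) = resp (⟦⟧-cong x≈y) (span-map hom gens p)
    where open IsHom hom

  -- The isomorphism is given as a map from `G` to `H`, so the generators are pulled back by
  -- surjectivity. Derivations of span membership are lifted step by step and compared with `x` by
  -- injectivity.
  generatedBy-≅ : G ≅ H → GeneratedBy H k → GeneratedBy G k
  generatedBy-≅ (f , iso) (t , spans) = (λ i → proj₁ (surjective (t i))) , λ x →
    let y , p , fy≈fx = lift (spans (f x)) in resp (injective fy≈fx) p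
    where
    open GroupMorphisms.IsGroupIsomorphism iso
    lift : ∀ {y} → Span H t y → ∃[ x ] Span G (λ i → proj₁ (surjective (t i))) x × f x H.≈ y
    lift (gen i) = _ , gen i , proj₂ (surjective (t i)) G.refl
    lift zero = _ , zero , ε-homo
    lift (add p q) = let _ , p′ , eqp = lift p ; _ , q′ , eqq = lift q in
      _ , add p′ q′ , H.trans (∙-homo _ _) (H.∙-cong eqp eqq)
    lift (neg p) = let _ , p′ , eq = lift p in _ , neg p′ , H.trans (⁻¹-homo _) (H.⁻¹-cong eq)
    lift (resp y≈z p) = let _ , p′ , eq = lift p in _ , p′ , H.trans eq y≈z

proj₁-hom : ∀ ns → n ℕ.∣ k → IsHom (⨁C (k ∷ ns)) (C n) proj₁
proj₁-hom ns n∣k = mkHom proj₁ (mod-∣ n∣k ∘ proj₁)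
  (λ _ _ → refl) refl (λ _ → refl)
  where open Mod _

proj₂-hom : ∀ n ns → IsHom (⨁C (n ∷ ns)) (⨁C ns) proj₂
proj₂-hom n ns = mkHom proj₂ proj₂ (λ _ _ → refl) refl (λ _ → refl)
  where open AbelianGroup (⨁C ns)

embed-hom : ∀ n ns → IsHom (⨁C ns) (⨁C (n ∷ ns)) (0ℤ ,_)
embed-hom n ns = mkHom (0ℤ ,_) (Mod.refl n ,_) (λ _ _ → refl) refl (λ _ → refl)
  where open AbelianGroup (⨁C (n ∷ ns))

⨁C-generated : ∀ ns → GeneratedBy (⨁C ns) (length ns)
⨁C-generated [] = (λ ()) , λ _ → zero
⨁C-generated (n ∷ ns) with s , spans ← ⨁C-generated ns = t , λ (x , y) →
  resp (Mod.reflexive n (ℤ.+-identityʳ x) , H.identityˡ y)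
    (add (multiple x) (span-map (embed-hom n ns) (λ i → gen (suc i)) (spans y)))
  where
  module H = AbelianGroup (⨁C ns)
  t = (1ℤ , H.ε) Vector.∷ λ i → 0ℤ , s i

  natMultiple : ∀ k → Span (⨁C (n ∷ ns)) t (+ k , H.ε)
  natMultiple ℕ.zero = zero
  natMultiple (ℕ.suc k) = resp (Mod.refl n , H.identityˡ H.ε) (add (gen zero) (natMultiple k))

  multiple : ∀ x → Span (⨁C (n ∷ ns)) t (x , H.ε)
  multiple (+ k) = natMultiple k
  multiple ℤ.-[1+ k ] = resp (Mod.refl n , H.trans (H.sym (H.identityˡ _)) (H.inverseʳ H.ε))
    (neg (natMultiple (ℕ.suc k)))

-- A surjective homomorphism onto the L-th power of the cyclic group of order n, split into its
-- coordinates. It can be pulled back along isomorphisms and along projections of direct sums.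
record Onto (G : AbelianGroup 0ℓ 0ℓ) (n L : ℕ) : Set where
  open AbelianGroup G using (Carrier)
  field
    π     : Fin L → Carrier → ℤ
    π-hom : ∀ i → IsHom G (C n) (π i)
    onto  : ∀ (z : Vector ℤ L) → ∃[ x ] ∀ i → π i x ≡ z i mod n

onto-∘ : ∀ {f} → IsHom G H f → (∀ y → ∃[ x ] AbelianGroup._≈_ H (f x) y) → Onto H n L → Onto G n L
onto-∘ {n = n} {f = f} hom surj onto-H = record
  { π = λ i → π i ∘ f
  ; π-hom = λ i → ∘-hom (π-hom i) hom
  ; onto = λ z → let y , eq = onto z ; x , fx≈y = surj y in
      x , λ i → Mod.trans n (IsHom.⟦⟧-cong (π-hom i) fx≈y) (eq i)
  }
  where open Onto onto-H

onto-≅ : G ≅ H → Onto H n L → Onto G n L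
onto-≅ {G} {H} (f , iso) = onto-∘ (isHom isGroupHomomorphism)
  λ y → let x , eq = surjective y in x , eq (AbelianGroup.refl G)
  where open GroupMorphisms.IsGroupIsomorphism iso

onto-∷ : ∀ ns → Onto (⨁C ns) n L → Onto (⨁C (k ∷ ns)) n L
onto-∷ {k = k} ns = onto-∘ (proj₂-hom k ns) λ y → (0ℤ , y) , AbelianGroup.refl (⨁C ns)

⨁C-onto : All (n ℕ.∣_) ns → Onto (⨁C ns) n (length ns)
⨁C-onto [] = record { π = λ () ; π-hom = λ () ; onto = λ _ → tt , λ () }
⨁C-onto {n} {k ∷ ns} (n∣k ∷ n∣ns) = record
  { π = λ { zero → proj₁ ; (suc i) → π i ∘ proj₂ }
  ; π-hom = λ { zero → proj₁-hom ns n∣k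
              ; (suc i) → ∘-hom (π-hom i) (proj₂-hom k ns) }
  ; onto = λ z → let y , eq = onto (tail z) in
      (head z , y) , λ { zero → Mod.refl n ; (suc i) → eq i }
  }
  where open Onto (⨁C-onto {ns = ns} n∣ns)

module _ (G : AbelianGroup 0ℓ 0ℓ) where
  open AbelianGroup G
  open RawMonoid rawMonoid using () renaming (_×_ to _·_)

  -- The subgroup bG is generated by k elements of the form b s.
  MultiplesGeneratedBy : ℕ → ℕ → Set
  MultiplesGeneratedBy b k =
    ∃[ s ] ∀ x → ∃[ y ] Span G {k} s y × b · x ≈ b · y

  generated⇒multiplesGenerated : ∀ b → GeneratedBy G k → MultiplesGeneratedBy b k
  generated⇒multiplesGenerated b (s , spans) = s , λ x → x , spans x , refl

  hom-· : ∀ {π} → IsHom G (C n) π → ∀ b x → π (b · x) ≡ (+ b ℤ.* π x) mod n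
  hom-· {n} {π} hom ℕ.zero x = Mod.trans n ε-homo (Mod.reflexive n (≡.sym (ℤ.*-zeroˡ (π x))))
    where open IsHom hom
  hom-· {n} {π} hom (ℕ.suc b) x = Mod.trans n (homo x (b · x)) (Mod.trans n
    (Mod.∙-congˡ n {π x} (hom-· hom b x)) (Mod.reflexive n (≡.sym (ℤ.suc-* (+ b) (π x)))))
    where open IsHom hom

  module _ {n L} (onto-G : Onto G n L) where
    open Onto onto-G
    open Mod n using () renaming (trans to infixr 5 _⨾_; sym to mod-sym)

    -- The same coefficients serve all coordinates at once, which is what makes the counting
    -- possible.
    span-coefficients : ∀ {s : Vector Carrier k} {x} → Span G s x →
      ∃[ c ] ∀ i → π i x ≡ dot c (π i ∘ s) mod n
    span-coefficients {s = s} (gen j) = unit j , λ i → Mod.reflexive n (≡.sym (dot-unit j (π i ∘ s)))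
    span-coefficients {s = s} zero = (λ _ → 0ℤ) , λ i →
      IsHom.ε-homo (π-hom i) ⨾ Mod.reflexive n (≡.sym (dot-0 (π i ∘ s)))
    span-coefficients (add p q) =
      let c , c-eq = span-coefficients p ; d , d-eq = span-coefficients q in
      (λ j → c j ℤ.+ d j) , λ i →
        IsHom.homo (π-hom i) _ _ ⨾ Mod.∙-cong n (c-eq i) (d-eq i) ⨾
        Mod.reflexive n (≡.sym (dot-+ c d _))
    span-coefficients (neg p) = let c , eq = span-coefficients p in
      (λ j → ℤ.- c j) , λ i →
        IsHom.⁻¹-homo (π-hom i) _ ⨾ Mod.⁻¹-cong n (eq i) ⨾
        Mod.reflexive n (≡.sym (dot-neg c _))
    span-coefficients (resp x≈y p) = let c , eq = span-coefficients p in
      c , λ i → mod-sym (IsHom.⟦⟧-cong (π-hom i) x≈y) ⨾ eq i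

    -- Lift z to x and write b x = b y with y in the span. Applying the coordinates gives b z ≡ b (c
    -- · v) for the coefficients c of y, and `few-multiples` applies.
    onto⇒∣ : .{{_ : ℕ.NonZero n}} → MultiplesGeneratedBy b k → k ℕ.< L → n ℕ.∣ b
    onto⇒∣ {b} {k} (s , spans) k<L = few-multiples k<L (λ i → π i ∘ s) λ z →
      let x , eq = onto z
          y , y∈ , bx≈by = spans x
          c , c-eq = span-coefficients y∈
      in c , λ i → mod-*ˡ (+ b) (mod-sym (eq i)) ⨾ mod-sym (hom-· (π-hom i) b x) ⨾
           IsHom.⟦⟧-cong (π-hom i) bx≈by ⨾
           hom-· (π-hom i) b y ⨾ mod-*ˡ (+ b) (c-eq i)

-- Multiplication by b annihilates the new summand, so the old generators with first coordinate 0
-- suffice.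
multiplesGenerated-∷ : ∀ ns → n ℕ.∣ b → MultiplesGeneratedBy (⨁C ns) b k →
  MultiplesGeneratedBy (⨁C (n ∷ ns)) b k
multiplesGenerated-∷ {n} {b} ns (ℕ.divides q ≡.refl) (s , spans) =
  (λ i → 0ℤ , s i) , λ (x , y) →
  let z , z∈ , by≈bz = spans y in
  (0ℤ , z) , span-map (embed-hom n ns) gen z∈ ,
  ≡.subst₂ G._≈_ (≡.sym (·≡scale (n ∷ ns) b (x , y))) (≡.sym (·≡scale (n ∷ ns) b (0ℤ , z)))
    (by (ℤ.divides (+ q ℤ.* x) (≡.trans (cong (λ t → t ℤ.* x ℤ.- t ℤ.* 0ℤ) (ℤ.pos-* q n))
       (rearrange (+ q) (+ n) x))) ,
     ≡.subst₂ H._≈_ (·≡scale ns b y) (·≡scale ns b z) by≈bz)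
  where
  module G = AbelianGroup (⨁C (n ∷ ns))
  module H = AbelianGroup (⨁C ns)
  rearrange : ∀ q n x → q ℤ.* n ℤ.* x ℤ.- q ℤ.* n ℤ.* 0ℤ ≡ q ℤ.* x ℤ.* n
  rearrange = solve-∀

multiplesGenerated-++ : ∀ ms ns → All (ℕ._∣ b) ms → MultiplesGeneratedBy (⨁C ns) b k →
  MultiplesGeneratedBy (⨁C (ms ++ ns)) b k
multiplesGenerated-++ [] ns [] p = p
multiplesGenerated-++ (m ∷ ms) ns (m∣b ∷ ms∣b) p =
  multiplesGenerated-∷ (ms ++ ns) m∣b (multiplesGenerated-++ ms ns ms∣b p)

-- Rank and invariant factors

chain⇒∣ : Linked ℕ._∣_ (n ∷ ns) → All (n ℕ.∣_) (n ∷ ns)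
chain⇒∣ = Linked.Linked⇒All ℕ.∣-trans ℕ.∣-refl

-- The case b = 1: the first factor n divides all of them, so `G` maps onto a power of the cyclic
-- group of order n with one coordinate per factor. Fewer generators than factors would give n ∣ 1.
generated⇒length≤ : (F : InvariantFactors G) → GeneratedBy G k →
  length (InvariantFactors.factors F) ≤ k
generated⇒length≤ {G} F G-gen with InvariantFactors.factors F | InvariantFactors.all>1 F
  | InvariantFactors.chain F | InvariantFactors.iso F
... | [] | _ | _ | _ = ℕ.z≤n
... | n ∷ ns | 1<n ∷ _ | chain | iso = ℕ.≮⇒≥ λ k<length → ℕ.>⇒∤ 1<n
  (onto⇒∣ G (onto-≅ iso (⨁C-onto (chain⇒∣ chain))) (generated⇒multiplesGenerated G 1 G-gen) k<length)
  where instance _ = ℕ.>-nonZero (ℕ.<⇒≤ 1<n)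

generatedBy-length : (F : InvariantFactors G) → GeneratedBy G (length (InvariantFactors.factors F))
generatedBy-length F = generatedBy-≅ (InvariantFactors.iso F) (⨁C-generated (InvariantFactors.factors F))

hasRank⇒length≡ : HasRank G k → (F : InvariantFactors G) → length (InvariantFactors.factors F) ≡ k
hasRank⇒length≡ (G-gen , least) F =
  ℕ.≤-antisym (generated⇒length≤ F G-gen) (least _ (generatedBy-length F))

length-hasRank : (F : InvariantFactors G) → HasRank G (length (InvariantFactors.factors F))
length-hasRank F = generatedBy-length F , λ _ → generated⇒length≤ F

sum≡sum∸1+length : All (1 ℕ.<_) ns → ℕ.sum ns ≡ ℕ.sum (map (ℕ._∸ 1) ns) + length ns
sum≡sum∸1+length [] = ≡.refl
sum≡sum∸1+length {ns = ℕ.suc n ∷ ns} (_ ∷ ns>1) = ≡.trans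
  (cong (ℕ.suc n ℕ.+_) (sum≡sum∸1+length ns>1)) (shift n (ℕ.sum (map (ℕ._∸ 1) ns)) (length ns))
  where
  shift : ∀ n s l → 1 + n + (s + l) ≡ n + s + (1 + l)
  shift = ℕ.solve-∀

-- The recursion follows a list of factors in increasing order: the head of a list with k further
-- entries is compared with `B k`.
sumBelow : (ℕ → ℕ) → ℕ → ℕ
sumBelow B ℕ.zero = 0
sumBelow B (ℕ.suc k) = B k + sumBelow B k

sumBelow-mono : ∀ B {k l} → k ≤ l → sumBelow B k ≤ sumBelow B l
sumBelow-mono B {l = l} ℕ.z≤n = ℕ.z≤n
sumBelow-mono B {k} {ℕ.suc l} k≤1+l with k ℕ.≟ ℕ.suc l
... | yes ≡.refl = ℕ.≤-refl
... | no k≢1+l = ℕ.≤-trans (sumBelow-mono B (ℕ.≤-pred (ℕ.≤∧≢⇒< k≤1+l k≢1+l))) (ℕ.m≤n+m _ (B l))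

-- An invariant factor followed by k further ones divides every b for which bG is generated by at
-- most k elements, so it is at most B k.
module _ {G : AbelianGroup 0ℓ 0ℓ} {B : ℕ → ℕ} (B≢0 : ∀ k → ℕ.NonZero (B k))
         (mult-gen : ∀ k → ∃[ l ] l ≤ k × MultiplesGeneratedBy G (B k) l) where

  -- The induction passes to tails of the list of factors. There `G` only projects onto the direct
  -- sum, so the hypothesis transfers surjections instead of giving an isomorphism.
  factors-sum≤ : ∀ ns → All (1 ℕ.<_) ns → Linked ℕ._∣_ ns →
    (∀ {n L} → Onto (⨁C ns) n L → Onto G n L) → ℕ.sum ns ≤ sumBelow B (length ns)
  factors-sum≤ [] _ _ _ = ℕ.z≤n
  factors-sum≤ (n ∷ ns) (1<n ∷ ns>1) chain onto-G =
    let l , l≤ , gen-l = mult-gen (length ns) in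
    ℕ.+-mono-≤
      (ℕ.∣⇒≤ {{B≢0 (length ns)}} (onto⇒∣ G (onto-G (⨁C-onto (chain⇒∣ chain))) gen-l (ℕ.s≤s l≤)))
      (factors-sum≤ ns ns>1 (Linked.tail chain) (onto-G ∘ onto-∷ ns))
    where instance _ = ℕ.>-nonZero (ℕ.<⇒≤ 1<n)

  Σn≤sumBelow : (F : InvariantFactors G) → GeneratedBy G k → InvariantFactors.Σn F ≤ sumBelow B k
  Σn≤sumBelow F G-gen = ℕ.≤-trans
    (factors-sum≤ factors all>1 chain (onto-≅ iso))
    (sumBelow-mono B (generated⇒length≤ F G-gen))
    where open InvariantFactors F

-- The groups Gₘᵣ

module GroupGₘᵣ (q m : ℕ) (2≤m : 2 ≤ m) where
  private instance
    m≢0 : ℕ.NonZero m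
    m≢0 = ℕ.>-nonZero (ℕ.<⇒≤ 2≤m)

  r : ℕ
  r = 8 + q

  large : List ℕ
  large = replicate 4 (2 * m) ++ List.[ 6 * m ]

  ms : List ℕ
  ms = replicate (3 + q) m ++ large

  group : AbelianGroup 0ℓ 0ℓ
  group = Gₘᵣ m r

  all-ms : ∀ {P : ℕ → Set} → P m → P (2 * m) → P (6 * m) → All P ms
  all-ms Pm P2m P6m = All.++⁺ (All.replicate⁺ (3 + q) Pm) (P2m ∷ P2m ∷ P2m ∷ P2m ∷ P6m ∷ [])

  m∣2m : m ℕ.∣ 2 * m
  m∣2m = ℕ.n∣m*n 2

  2m∣6m : 2 * m ℕ.∣ 6 * m
  2m∣6m = ℕ.*-monoˡ-∣ m (ℕ.divides {2} {6} 3 ≡.refl)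

  ms-chain : Linked ℕ._∣_ ms
  -- An extra m in front gives the recursion a head to compare with at every stage; `Linked.tail`
  -- removes it.
  ms-chain = Linked.tail (go (3 + q))
    where
    go : ∀ k → Linked ℕ._∣_ (m ∷ replicate k m ++ large)
    go ℕ.zero = m∣2m ∷ ℕ.∣-refl ∷ ℕ.∣-refl ∷ ℕ.∣-refl ∷ 2m∣6m ∷ [-]
    go (ℕ.suc k) = ℕ.∣-refl ∷ go k

  invariantFactors : InvariantFactors group
  invariantFactors = record
    { factors = ms
    ; all>1 = all-ms 2≤m (ℕ.≤-trans 2≤m (ℕ.m≤n*m m 2)) (ℕ.≤-trans 2≤m (ℕ.m≤n*m m 6))
    ; chain = ms-chain
    ; iso = id , Identity.isGroupIsomorphism (AbelianGroup.rawGroup group) (AbelianGroup.refl group)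
    }

  finite : Finite group
  finite = ⨁C-finite (all-ms m≢0 (ℕ.m*n≢0 2 m) (ℕ.m*n≢0 6 m))

  length-ms : length ms ≡ r
  length-ms = ≡.trans (List.length-++ (replicate (3 + q) m)) (≡.trans
    (cong (_+ 5) (List.length-replicate (3 + q))) (ℕ.+-comm (3 + q) 5))

  hasRank : HasRank group r
  hasRank = subst (HasRank group) length-ms (length-hasRank invariantFactors)

  factorBound : ℕ → ℕ
  factorBound 0 = 6 * m
  factorBound 1 = 2 * m
  factorBound 2 = 2 * m
  factorBound 3 = 2 * m
  factorBound 4 = 2 * m
  factorBound _ = m

  factorBound-cases : ∀ (P : ℕ → ℕ → Set) → P 0 (6 * m) → (∀ k → P (ℕ.suc k) (2 * m)) →
    (∀ k → P (5 + k) m) → ∀ k → P k (factorBound k)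
  factorBound-cases P p₀ p₁ p₅ 0 = p₀
  factorBound-cases P p₀ p₁ p₅ 1 = p₁ 0
  factorBound-cases P p₀ p₁ p₅ 2 = p₁ 1
  factorBound-cases P p₀ p₁ p₅ 3 = p₁ 2
  factorBound-cases P p₀ p₁ p₅ 4 = p₁ 3
  factorBound-cases P p₀ p₁ p₅ (ℕ.suc (ℕ.suc (ℕ.suc (ℕ.suc (ℕ.suc k))))) = p₅ k

  -- The multiplier 6m annihilates every summand, 2m all but the last, and m all but the last five.
  -- This leaves 0, 1 and 5 generators.
  multiplesGenerated : ∀ k → ∃[ l ] l ≤ k × MultiplesGeneratedBy group (factorBound k) l
  multiplesGenerated = factorBound-cases (λ k b → ∃[ l ] l ≤ k × MultiplesGeneratedBy group b l)
    (0 , ℕ.z≤n , skip-small (6 * m) (ℕ.n∣m*n 6) (skip-2m (6 * m) 2m∣6m (multiplesGenerated-++ List.[ 6 * m ] []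
      (ℕ.∣-refl ∷ []) (generated⇒multiplesGenerated (⨁C []) (6 * m) (⨁C-generated [])))))
    (λ k → 1 , ℕ.s≤s ℕ.z≤n , skip-small (2 * m) m∣2m (skip-2m (2 * m) ℕ.∣-refl
      (generated⇒multiplesGenerated (⨁C List.[ 6 * m ]) (2 * m) (⨁C-generated List.[ 6 * m ]))))
    (λ k → 5 , ℕ.m≤m+n 5 k , skip-small m ℕ.∣-refl
      (generated⇒multiplesGenerated (⨁C large) m (⨁C-generated large)))
    where
    skip-small : ∀ b {k} → m ℕ.∣ b → MultiplesGeneratedBy (⨁C large) b k → MultiplesGeneratedBy group b k
    skip-small b m∣b = multiplesGenerated-++ (replicate (3 + q) m) large (All.replicate⁺ (3 + q) m∣b)

    skip-2m : ∀ b {k} → 2 * m ℕ.∣ b → MultiplesGeneratedBy (⨁C List.[ 6 * m ]) b k →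
      MultiplesGeneratedBy (⨁C large) b k
    skip-2m b 2m∣b = multiplesGenerated-++ (replicate 4 (2 * m)) List.[ 6 * m ] (All.replicate⁺ 4 2m∣b)

  sumBelow-factorBound : ∀ k → sumBelow factorBound (5 + k) ≡ (14 + k) * m
  sumBelow-factorBound ℕ.zero = collect m
    where
    collect : ∀ m → 2 * m + (2 * m + (2 * m + (2 * m + (6 * m + 0)))) ≡ 14 * m
    collect = ℕ.solve-∀
  sumBelow-factorBound (ℕ.suc k) = cong (m ℕ.+_) (sumBelow-factorBound k)

  -- The failure of the formula is asserted for every decomposition `F`, so an arbitrary one is
  -- bounded. The coefficient is 6 + 4 · 2 + (3 + q) = r + 9.
  Σn≤ : (F : InvariantFactors group) → InvariantFactors.Σn F ≤ (r + 9) * m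
  Σn≤ F = subst (InvariantFactors.Σn F ℕ.≤_)
    (≡.trans (sumBelow-factorBound (3 + q)) (cong (_* m) (ℕ.+-comm 9 r)))
    (Σn≤sumBelow (factorBound-cases (λ _ → ℕ.NonZero) (ℕ.m*n≢0 6 m) (λ _ → ℕ.m*n≢0 2 m) (λ _ → m≢0))
      multiplesGenerated F (proj₁ hasRank))

  sequenceLength : ℕ → ℕ
  sequenceLength ℕ.zero = ℕ.sum (map proj₁ (powers₈ m))
  sequenceLength (ℕ.suc k) = ℕ.pred m + sequenceLength k

  ∃zeroSumFree : ∀ k → ∃[ g ] ZeroSumFreeSequences.ZeroSumFree
    (⨁C (replicate k m ++ factors₈ m)) {sequenceLength k} g
  ∃zeroSumFree ℕ.zero = _ , powers₈-zeroSumFree m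
  ∃zeroSumFree (ℕ.suc k) =
    _ , zeroSumFree-∷ m (replicate k m ++ factors₈ m) (proj₂ (∃zeroSumFree k))

  ms≡ : replicate q m ++ factors₈ m ≡ ms
  ms≡ = go q
    where
    go : ∀ k → replicate k m ++ factors₈ m ≡ replicate (3 + k) m ++ large
    go ℕ.zero = ≡.refl
    go (ℕ.suc k) = cong (m ∷_) (go k)

  -- Each of the r listed terms occurs one time fewer than 2m (seven terms), 4m (one term) or m (q
  -- terms). Adding r therefore gives (14 + 4 + q) m.
  sequenceLength+r : sequenceLength q + r ≡ (r + 10) * m
  sequenceLength+r = ≡.trans (go q) (cong (_* m) (ℕ.+-comm 10 r))
    where
    collect₈ : ∀ a b → a + (a + (a + (a + (a + (a + (a + (b + 0))))))) + 8
      ≡ 7 * (1 + a) + (1 + b)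
    collect₈ = ℕ.solve-∀

    collect₁ : ∀ m → 7 * (2 * m) + 4 * m ≡ 18 * m
    collect₁ = ℕ.solve-∀

    collect : ∀ a s k → a + s + (8 + (1 + k)) ≡ (1 + a) + (s + (8 + k))
    collect = ℕ.solve-∀

    go : ∀ k → sequenceLength k + (8 + k) ≡ (18 + k) * m
    go ℕ.zero = ≡.trans (collect₈ (ℕ.pred (2 * m)) (ℕ.pred (4 * m))) (≡.trans
      (cong₂ (λ a b → 7 * a + b) (ℕ.suc-pred (2 * m) {{ℕ.m*n≢0 2 m}})
                                     (ℕ.suc-pred (4 * m) {{ℕ.m*n≢0 4 m}}))
      (collect₁ m))
    go (ℕ.suc k) = ≡.trans (collect (ℕ.pred m) (sequenceLength k) k)
      (cong₂ _+_ (ℕ.suc-pred m) (go k))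

  -- A witness that the sequence is nonempty, obtained from r < (r + 10) m.
  index : Fin (sequenceLength q)
  index = Fin.fromℕ< (ℕ.+-cancelʳ-< r 0 (sequenceLength q) (subst (r ℕ.<_) (≡.sym sequenceLength+r)
    (ℕ.≤-trans (ℕ.m≤m+n (ℕ.suc r) 9) (subst (_≤ (r + 10) * m) (ℕ.+-suc r 9) (ℕ.m≤m*n (r + 10) m)))))

  admissible : N₁-Admissible group (ℕ.suc (sequenceLength q))
  admissible = ZeroSumFreeSequences.zeroSumFree⇒N₁-admissible group (proj₂ zsf) finite index
    where
    zsf : ∃[ g ] ZeroSumFreeSequences.ZeroSumFree group {sequenceLength q} g
    zsf = subst (λ ns → ∃[ g ] ZeroSumFreeSequences.ZeroSumFree (⨁C ns) {sequenceLength q} g) ms≡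
      (∃zeroSumFree q)

  -- Abstract, since unfolding the search for N is prohibitively expensive.
  abstract
    ∃N₁-large : ∃[ N ] IsN₁ group N × (r + 10) * m ℕ.< N + r
    ∃N₁-large = let N , ℓ≤N , isN₁ = FiniteGroup.∃N₁ group finite _ admissible in
      N , isN₁ , subst (ℕ._< N + r) sequenceLength+r (ℕ.+-monoˡ-≤ r ℓ≤N)

-- The lower bound and unboundedness of the difference

+-≤⇒-≤ : ∀ {a b c d} → a + d ≤ c + b → + a ℤ.- + b ℤ.≤ + c ℤ.- + d
+-≤⇒-≤ {a} {b} {c} {d} a+d≤c+b = ≡.subst₂ ℤ._≤_ (cancelʳ (+ a) (+ b) (+ d)) (cancelˡ (+ c) (+ b) (+ d))
  (ℤ.+-monoˡ-≤ (ℤ.- (+ b ℤ.+ + d)) (ℤ.+≤+ a+d≤c+b))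
  where
  cancelʳ : ∀ a b d → a ℤ.+ d ℤ.- (b ℤ.+ d) ≡ a ℤ.- b
  cancelʳ = solve-∀
  cancelˡ : ∀ c b d → c ℤ.+ b ℤ.- (b ℤ.+ d) ≡ c ℤ.- d
  cancelˡ = solve-∀

N₁-gap : ∀ {N r m} → (r + 10) * m ℕ.< N + r → 1 + m + (r + 9) * m ≤ N + r
N₁-gap {N} {r} {m} = subst (_≤ N + r) (collect r m)
  where
  collect : ∀ r m → 1 + (r + 10) * m ≡ 1 + m + (r + 9) * m
  collect = ℕ.solve-∀

corollary4p1 : (∀ (r m : ℕ) → 8 ≤ r → 2 ≤ m →
    ∃[ N ] IsN₁ (Gₘᵣ m r) N
    × (+ N ℤ.- + ((r + 9) * m) ℤ.≥ + m ℤ.- + r ℤ.+ 1ℤ)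
    × (r ≤ m → ∀ (F : InvariantFactors (Gₘᵣ m r)) → N ≢ InvariantFactors.Σn F))
    × (∀ (r : ℕ) → 8 ≤ r →
    (∀ (G : AbelianGroup 0ℓ 0ℓ) → Finite G → HasRank G r →
    ∀ (F : InvariantFactors G) → InvariantFactors.Σn F ≡ InvariantFactors.d* F + r)
    × (∀ (B : ℕ) →
    Σ[ G ∈ AbelianGroup 0ℓ 0ℓ ] Finite G × HasRank G r
    × (Σ[ F ∈ InvariantFactors G ] ∃[ N ] IsN₁ G N
    × (+ N ℤ.- + InvariantFactors.Σn F ℤ.> + B))))
corollary4p1 = lowerBound , λ r 8≤r → (λ G _ rank F → Σn≡d*+r rank F) , unbounded r 8≤r
  where
  lowerBound : ∀ r m → 8 ≤ r → 2 ≤ m →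
    ∃[ N ] IsN₁ (Gₘᵣ m r) N
      × (+ N ℤ.- + ((r + 9) * m) ℤ.≥ + m ℤ.- + r ℤ.+ 1ℤ)
      × (r ≤ m → ∀ (F : InvariantFactors (Gₘᵣ m r)) → N ≢ InvariantFactors.Σn F)
  lowerBound r m 8≤r 2≤m with q , ≡.refl ← ℕ.m≤n⇒∃[o]m+o≡n 8≤r =
    let N , isN₁ , large = ∃N₁-large
        gap = N₁-gap {N} {r} {m} large
    in N , isN₁
     , subst (ℤ._≤ + N ℤ.- + ((r + 9) * m)) (move (+ m) (+ r)) (+-≤⇒-≤ {1 + m} {r} gap)
     -- For r ≤ m the gap yields N > (r + 9) m, which is at least the sum of the factors in `F`.
     , λ r≤m F N≡Σn → ℕ.<-irrefl (≡.sym N≡Σn) (ℕ.≤-<-trans (Σn≤ F)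
         (ℕ.+-cancelˡ-≤ m _ _ (exceeds N r≤m gap)))
    where
    open GroupGₘᵣ q m 2≤m hiding (r)
    move : ∀ m r → 1ℤ ℤ.+ m ℤ.- r ≡ m ℤ.- r ℤ.+ 1ℤ
    move = solve-∀
    exceeds : ∀ N → r ≤ m → 1 + m + (r + 9) * m ≤ N + r →
      m + (1 + (r + 9) * m) ≤ m + N
    exceeds N r≤m gap = subst (_≤ m + N) (≡.sym (ℕ.+-suc m _))
      (ℕ.≤-trans gap (subst (N + r ℕ.≤_) (ℕ.+-comm N m) (ℕ.+-monoʳ-≤ N r≤m)))

  Σn≡d*+r : ∀ {G r} → HasRank G r → ∀ (F : InvariantFactors G) →
    InvariantFactors.Σn F ≡ InvariantFactors.d* F + r
  Σn≡d*+r rank F = ≡.trans (sum≡sum∸1+length (InvariantFactors.all>1 F))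
    (cong (InvariantFactors.d* F ℕ.+_) (hasRank⇒length≡ rank F))

  unbounded : ∀ r → 8 ≤ r → ∀ B → Σ[ G ∈ AbelianGroup 0ℓ 0ℓ ] Finite G × HasRank G r
    × (Σ[ F ∈ InvariantFactors G ] ∃[ N ] IsN₁ G N × (+ N ℤ.- + InvariantFactors.Σn F ℤ.> + B))
  unbounded r 8≤r B with q , ≡.refl ← ℕ.m≤n⇒∃[o]m+o≡n 8≤r =
    let N , isN₁ , large = ∃N₁-large
    in group , finite , hasRank , invariantFactors , N , isN₁
     , ℤ.<-≤-trans (ℤ.+<+ (ℕ.n<1+n B)) (subst (ℤ._≤ + N ℤ.- + InvariantFactors.Σn invariantFactors)
         (ℤ.+-identityʳ (+ ℕ.suc B)) (+-≤⇒-≤ {ℕ.suc B} {0} (exceeds N (N₁-gap {N} {r} {m} large))))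
    where
    -- With this choice the gap m - r + 1 equals B + 1.
    m = B + r
    open GroupGₘᵣ q m (ℕ.≤-trans (ℕ.m≤m+n 2 _) (ℕ.m≤n+m r B)) hiding (r)
    Σn = InvariantFactors.Σn invariantFactors

    swap : ∀ B r s → 1 + (B + r) + s ≡ r + (1 + B + s)
    swap = ℕ.solve-∀

    exceeds : ∀ N → 1 + m + (r + 9) * m ≤ N + r → ℕ.suc B + Σn ≤ N + 0
    exceeds N gap = ℕ.≤-trans (ℕ.+-cancelˡ-≤ r _ _ (ℕ.≤-trans
      (subst (r + (ℕ.suc B + Σn) ℕ.≤_) (≡.sym (swap B r ((r + 9) * m)))
        (ℕ.+-monoʳ-≤ r (ℕ.+-monoʳ-≤ (ℕ.suc B) (Σn≤ invariantFactors))))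
      (subst (1 + m + (r + 9) * m ℕ.≤_) (ℕ.+-comm N r) gap)))
      (ℕ.≤-reflexive (≡.sym (ℕ.+-identityʳ N)))
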